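{- For every finite $c>0$ and all ordinals $\beta,\alpha$ with $2\le\beta<\alpha<\varepsilon_0$, $$\mathbf F^c_\beta\subsetneq\mathbf F^{c+1}_\beta\subsetneq\mathbf F_\alpha.$$
   Context: Ordinals are below $\varepsilon_0$ in Cantor normal form; limit ordinals have fundamental sequences $(\gamma+\omega^{\beta+1})(x)=\gamma+\omega^\beta\cdot(x+1)$, $(\gamma+\omega^{\lambda'})(x)=\gamma+\omega^{\lambda'(x)}$ for $\lambda'$ limit. Fast-growing functions: $F_0(x)=x+1$, $F_{\alpha+1}(x)=F_\alpha^{x+1}(x)$, $F_\lambda(x)=F_{\lambda(x)}(x)$; $F^c_\alpha$ is the $c$-fold iterate. Extended Grzegorczyk class $\mathscr F_\alpha$: smallest class of functions $\mathbb N^k\to\mathbb N$ containing the zero function, addition, projections and $F_\alpha$, closed under composition and limited primitive recursion (primitive recursion bounded by some function of the class applied to the max of the arguments). $\mathscr F_{<\alpha}=\bigcup_{\beta<\alpha}\mathscr F_\beta$. $\mathrm{DTime}(t(n))$: languages decided by a deterministic Turing machine in at most $t(n)$ steps on inputs of length $n$. For finite $c>0$, $\mathbf F^c_\alpha=\bigcup_{p\in\mathscr F_{<\alpha}}\mathrm{DTime}(F^c_\alpha(p(n)))$ ($p$ unary), and $\mathbf F_\alpha=\mathbf F^1_\alpha$. -}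

module Defs where

open import Data.Nat using (ℕ; zero; suc; _+_; _≤_; _<_; _⊔_)
open import Data.Fin using (Fin; zero; suc)
open import Data.Vec using (Vec; []; _∷_; lookup; head; tabulate; foldr)
open import Data.List using (List; []; _∷_; length; map)
open import Data.Bool using (Bool; true; false)
open import Data.Maybe using (Maybe; just; nothing)
open import Data.Product using (Σ; _×_; _,_)
open import Data.Sum using (_⊎_)
open import Relation.Binary.PropositionalEquality using (_≡_)
open import Relation.Nullary using (¬_)

-- Ordinals below ε₀ as Cantor-normal-form terms
-- ω^ a + b  denotes  ω^a + b

data Ord : Set where
  𝟎    : Ord
  ω^_+_ : Ord → Ord → Ord

data _<ₒ_ : Ord → Ord → Set where
  z<  : ∀ {a b} → 𝟎 <ₒ (ω^ a + b)
  e<  : ∀ {a b c d} → a <ₒ c → (ω^ a + b) <ₒ (ω^ c + d)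
  t<  : ∀ {a b d} → b <ₒ d → (ω^ a + b) <ₒ (ω^ a + d)

_≤ₒ_ : Ord → Ord → Set
a ≤ₒ b = (a <ₒ b) ⊎ (a ≡ b)

LeadLE : Ord → Ord → Set
LeadLE a 𝟎 = Data.Unit.⊤ where import Data.Unit
LeadLE a (ω^ c + d) = c ≤ₒ a

data IsCNF : Ord → Set where
  cnf𝟎 : IsCNF 𝟎
  cnfω : ∀ {a b} → IsCNF a → IsCNF b → LeadLE a b → IsCNF (ω^ a + b)

one two : Ord
one = ω^ 𝟎 + 𝟎
two = ω^ 𝟎 + (ω^ 𝟎 + 𝟎)

data Kind : Set where
  zer  : Kind
  succ : Ord → Kind
  lim  : Kind

extKind : Ord → Kind → Kind
extKind a zer      = zer
extKind a (succ b) = succ (ω^ a + b)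
extKind a lim      = lim

kind : Ord → Kind
kind 𝟎                      = zer
kind (ω^ 𝟎 + 𝟎)             = succ 𝟎
kind (ω^ (ω^ c + d) + 𝟎)    = lim
kind (ω^ a + (ω^ c + d))    = extKind a (kind (ω^ c + d))

-- ω^a · (n+1) = ω^a + ... + ω^a   (n+1 summands)
ωtimes : Ord → ℕ → Ord
ωtimes a zero    = ω^ a + 𝟎
ωtimes a (suc n) = ω^ a + ωtimes a n

-- Fundamental sequences:
--   (γ + ω^(β+1))(x) = γ + ω^β·(x+1),  (γ + ω^λ)(x) = γ + ω^(λ(x))
fundLast : Kind → Ord → ℕ → Ord
fundLast zer      a x = 𝟎
fundLast (succ a') a x = ωtimes a' x
fundLast lim      a x = ω^ a + 𝟎

fund : Ord → ℕ → Ord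
fund 𝟎 x                   = 𝟎
fund (ω^ a + 𝟎) x          = fundLast (kind a) (fund a x) x
fund (ω^ a + (ω^ c + d)) x = ω^ a + fund (ω^ c + d) x

-- Fast-growing hierarchy, as the graph of F_α (F α x y means F_α(x) = y)

data Iter (R : ℕ → ℕ → Set) : ℕ → ℕ → ℕ → Set where
  it0 : ∀ {x} → Iter R zero x x
  itS : ∀ {n x y z} → R x y → Iter R n y z → Iter R (suc n) x z

data FG : Ord → ℕ → ℕ → Set where
  fg0   : ∀ {x} → FG 𝟎 x (suc x)
  fgSuc : ∀ {α β x y} → kind α ≡ succ β → Iter (FG β) (suc x) x y → FG α x y
  fgLim : ∀ {α x y} → kind α ≡ lim → FG (fund α x) x y → FG α x y

maxV : ∀ {k} → Vec ℕ k → ℕ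
maxV = foldr _ _⊔_ 0

data 𝓕 (α : Ord) : (k : ℕ) → (Vec ℕ k → ℕ) → Set where
  zeroF : ∀ {k} → 𝓕 α k (λ _ → 0)
  addF  : 𝓕 α 2 (λ v → lookup v zero + lookup v (suc zero))
  projF : ∀ {k} (i : Fin k) → 𝓕 α k (λ v → lookup v i)
  fastF : (f : ℕ → ℕ) → (∀ x → FG α x (f x)) → 𝓕 α 1 (λ v → f (head v))
  compF : ∀ {m k f} (gs : Fin m → Vec ℕ k → ℕ) →
          𝓕 α m f → ((i : Fin m) → 𝓕 α k (gs i)) →
          𝓕 α k (λ v → f (tabulate (λ i → gs i v)))
  lprF  : ∀ {k g h b} (r : Vec ℕ (suc k) → ℕ) →
          𝓕 α k g → 𝓕 α (suc (suc k)) h → 𝓕 α 1 b →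
          (∀ v → r (0 ∷ v) ≡ g v) →
          (∀ y v → r (suc y ∷ v) ≡ h (y ∷ r (y ∷ v) ∷ v)) →
          (∀ v → r v ≤ b (maxV v ∷ [])) →
          𝓕 α (suc k) r
  -- classes of functions are taken extensionally
  extF  : ∀ {k f g} → 𝓕 α k f → (∀ v → f v ≡ g v) → 𝓕 α k g

𝓕< : Ord → (ℕ → ℕ) → Set
𝓕< α p = Σ Ord (λ β → IsCNF β × (β <ₒ α) × 𝓕 β 1 (λ v → p (head v)))

-- Deterministic (single-tape, two-way infinite) Turing machines over
-- input alphabet Bool.  Tape alphabet Fin (3 + G): 0 = blank,
-- 1 = input symbol false, 2 = input symbol true.  States Fin (suc Q),
-- start state zero.

data Move : Set where
  mL mR mS : Move

data Action (Q G : ℕ) : Set where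
  halt : Bool → Action Q G                         -- halt, accept iff true
  go   : Fin (suc Q) → Fin (3 + G) → Move → Action Q G

record TM : Set where
  field
    Q : ℕ
    G : ℕ
    δ : Fin (suc Q) → Fin (3 + G) → Action Q G

record Config (Q G : ℕ) : Set where
  constructor cfg
  field
    state : Fin (suc Q)
    left  : List (Fin (3 + G))   -- cells left of the head, nearest first
    cur   : Fin (3 + G)
    right : List (Fin (3 + G))   -- cells right of the head, nearest first

blank : ∀ {G} → Fin (3 + G)
blank = zero

moveC : ∀ {Q G} → Move → Fin (suc Q) → List (Fin (3 + G)) → Fin (3 + G) →
        List (Fin (3 + G)) → Config Q G
moveC mL q []       s rs       = cfg q [] blank (s ∷ rs)
moveC mL q (l ∷ ls) s rs       = cfg q ls l (s ∷ rs)
moveC mR q ls       s []       = cfg q (s ∷ ls) blank []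
moveC mR q ls       s (r ∷ rs) = cfg q (s ∷ ls) r rs
moveC mS q ls       s rs       = cfg q ls s rs

runAct : (M : TM) → ℕ → Config (TM.Q M) (TM.G M) → Maybe Bool
runWith : (M : TM) → ℕ → Config (TM.Q M) (TM.G M) →
          Action (TM.Q M) (TM.G M) → Maybe Bool
runWith M n c (halt b) = just b
runWith M zero c (go q s m) = nothing
runWith M (suc n) (cfg _ ls _ rs) (go q s m) = runAct M n (moveC m q ls s rs)
runAct M n c = runWith M n c (TM.δ M (Config.state c) (Config.cur c))

inSym : ∀ {G} → Bool → Fin (3 + G)
inSym false = suc zero
inSym true  = suc (suc zero)

initC : ∀ {Q G} → List Bool → Config Q G
initC []      = cfg zero [] blank []
initC (b ∷ w) = cfg zero [] (inSym b) (map inSym w)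

Language : Set
Language = List Bool → Bool

-- M decides L in time t, where t is given by its graph T (T n y : t(n) = y)
DecidesIn : TM → (ℕ → ℕ → Set) → Language → Set
DecidesIn M T L = ∀ w y → T (length w) y → runAct M y (initC w) ≡ just (L w)

-- Complexity classes  𝐅^c_α = ⋃_{p ∈ 𝓕_{<α}} DTime(F_α^c(p(n)))

𝐅 : ℕ → Ord → Language → Set
𝐅 c α L = Σ (ℕ → ℕ) (λ p → 𝓕< α p ×
            Σ TM (λ M → DecidesIn M (λ n y → Iter (FG α) c (p n) y) L))

_⊆C_ : (Language → Set) → (Language → Set) → Set
X ⊆C Y = ∀ L → X L → Y L

_⊊C_ : (Language → Set) → (Language → Set) → Set
X ⊊C Y = (X ⊆C Y) × Σ Language (λ L → Y L × ¬ X L)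

{-# OPTIONS --safe #-}
module Submission where

-- Every p ∈ 𝓕_{<β} is bounded by an iterate of some F_δ with δ < β, and those
-- iterates are eventually dominated by F_β; this gives the inclusions, with
-- p′(n) = n + C.  Since K (F_β x + 1)² ≤ F_β (4x + K + 2) for β ≥ 2, polynomial
-- overheads are absorbed by a linear change of the argument.
--
-- Strictness is a diagonal argument; the second one follows from the first at
-- c + 1 and the inclusion of 𝐅^{c+2}_β in 𝐅_α.  The machine for 𝐅^{c+1}_β first
-- computes y = F_β^{c+1}(n + 2) in unary by playing the worm (or hydra) game on
-- the term ω^β · (c + 1): its fundamental sequences are exactly those of the
-- game with x + 1 copies, x being the number of leaves removed so far (plus
-- n + 2), so that x ends as y, and the time is linear in y.  It then uses y as
-- fuel to simulate the machine encoded by its own input, and negates the answer.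
-- It is a machine with seven stacks, which become tracks of a single tape.

open import Defs
open import Data.Bool using (Bool; true; false; not)
open import Data.Bool.Properties using (not-¬)
open import Data.Empty using (⊥-elim)
open import Data.Fin using (Fin; zero; suc; toℕ; inject₁; funToFin; finToFun; combine; remQuot; join; splitAt)
open import Data.Fin.Patterns
import Data.Fin.Properties as Fin
open import Data.List using (List; []; _∷_; _++_; _∷ʳ_; _ʳ++_; length; map; reverse; drop; replicate)
import Data.List as List
import Data.List.Properties as List
open import Data.List.Relation.Unary.All using (All; []; _∷_) renaming (map to mapAll)
open import Data.Maybe using (Maybe; just; nothing; maybe′)
open import Data.Maybe.Properties using (just-injective)
open import Data.Nat using (ℕ; zero; suc; _+_; _*_; _∸_; _^_; _≤_; _<_; _≥_; _⊔_; z≤n; s≤s)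
open import Data.Nat.Properties
open import Data.Nat.Tactic.RingSolver using (solve-∀)
open import Data.Product using (Σ; _×_; _,_; proj₁; proj₂; uncurry)
open import Data.Sum using (_⊎_; inj₁; inj₂) renaming (map to map⊎)
open import Data.Unit using (⊤; tt)
open import Data.Vec using (Vec; []; _∷_; lookup; head; _[_]≔_)
import Data.Vec as Vec
open import Data.Vec.Functional using (updateAt)
import Data.Vec.Functional.Properties as VF
import Data.Vec.Properties as Vec
open import Function using (_∘_; const)
open import Relation.Binary.PropositionalEquality
open import Relation.Nullary using (¬_; does; yes; no)
open import Relation.Nullary.Decidable using (dec-false; dec-true)

-- The diagonal machine must compute its clock within a time controlled by the clock's own value.
-- The game achieves this because it evaluates a Hardy function: H at ω^β · (c + 1) is F_β^(c+1). A
-- label 0 on top is the step +1, and every other move only unfolds a fundamental sequence. The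
-- copying in a move is paid for by the labels it creates. This fails when a cut merely preserves
-- the number of labels, hence the start at n + 2. With all stacks on one tape, each instruction is
-- a sweep over the tape, so linear stack time becomes quadratic time; this is where the squares
-- come from. F_1 is linear and cannot absorb a square, whereas F_2 is exponential and can. A time
-- bound F_β^c(p(n)) falls below the clock only from some length on. A table is therefore followed
-- by padding, which gives every machine arbitrarily long codes. Exhausted fuel means rejection, so
-- the diagonal machine always halts and its verdict defines a language.

-- Iterates of monotone and inflationary functions

iter : (ℕ → ℕ) → ℕ → ℕ → ℕ
iter f zero    x = x
iter f (suc n) x = iter f n (f x)

iter-+ : ∀ f m n x → iter f (m + n) x ≡ iter f n (iter f m x)
iter-+ f zero    n x = refl
iter-+ f (suc m) n x = iter-+ f m n (f x)

Mono : (ℕ → ℕ) → Set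
Mono f = ∀ {x y} → x ≤ y → f x ≤ f y

Infl : (ℕ → ℕ) → Set
Infl f = ∀ x → x < f x

iter-mono : ∀ {f} → Mono f → ∀ n → Mono (iter f n)
iter-mono f-mono zero    p = p
iter-mono f-mono (suc n) p = iter-mono f-mono n (f-mono p)

iter-adds : ∀ {f} → Infl f → ∀ n x → n + x ≤ iter f n x
iter-adds f-infl zero    x = ≤-refl
iter-adds f-infl (suc n) x =
  ≤-trans (≤-reflexive (sym (+-suc n x)))
    (≤-trans (+-monoʳ-≤ n (f-infl x)) (iter-adds f-infl n _))

iter-infl : ∀ {f} → Infl f → ∀ n x → x ≤ iter f n x
iter-infl f-infl n x = ≤-trans (m≤n+m x n) (iter-adds f-infl n x)

iter-count : ∀ {f} → Infl f → ∀ {m n} → m ≤ n → ∀ x → iter f m x ≤ iter f n x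
iter-count f-infl {n = n} z≤n       x = iter-infl f-infl n x
iter-count f-infl         (s≤s m≤n) x = iter-count f-infl m≤n _

-- Ordinal terms and their descent

kind-tail : ∀ a c d → kind (ω^ a + (ω^ c + d)) ≡ extKind a (kind (ω^ c + d))
kind-tail 𝟎          c d = refl
kind-tail (ω^ _ + _) c d = refl

kind-tail-succ : ∀ a b {b′} → kind b ≡ succ b′ → kind (ω^ a + b) ≡ succ (ω^ a + b′)
kind-tail-succ a (ω^ c + d) k = trans (kind-tail a c d) (cong (extKind a) k)

kind-tail-lim : ∀ a b → kind b ≡ lim → kind (ω^ a + b) ≡ lim
kind-tail-lim a (ω^ c + d) k = trans (kind-tail a c d) (cong (extKind a) k)

fund-tail : ∀ a b → kind b ≡ lim → ∀ x → fund (ω^ a + b) x ≡ ω^ a + fund b x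
fund-tail a (ω^ c + d) k x = refl

fund-pow-succ : ∀ a {a′} → kind a ≡ succ a′ → ∀ x → fund (ω^ a + 𝟎) x ≡ ωtimes a′ x
fund-pow-succ a k x rewrite k = refl

fund-pow-lim : ∀ a → kind a ≡ lim → ∀ x → fund (ω^ a + 𝟎) x ≡ ω^ fund a x + 𝟎
fund-pow-lim a k x rewrite k = refl

kind-pow-lim : ∀ a → kind a ≢ zer → kind (ω^ a + 𝟎) ≡ lim
kind-pow-lim 𝟎          a≢0 = ⊥-elim (a≢0 refl)
kind-pow-lim (ω^ _ + _) _   = refl

succ≢zer : ∀ {k a} → k ≡ succ a → k ≢ zer
succ≢zer refl ()

lim≢zer : ∀ {k} → k ≡ lim → k ≢ zer
lim≢zer refl ()

-- Accessibility along predecessors and along all members of fundamental sequences. Since `fund a x`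
-- is not a subterm of `a`, the function `F` is defined by structural recursion on this proof
-- instead of on the term.
data Tree : Ord → Set where
  tz : Tree 𝟎
  ts : ∀ {a b} → kind a ≡ succ b → Tree b → Tree a
  tl : ∀ {a} → kind a ≡ lim → (∀ x → Tree (fund a x)) → Tree a

tree-+ : ∀ {a b} → Tree (ω^ a + 𝟎) → Tree b → Tree (ω^ a + b)
tree-+     ta tz       = ta
tree-+ {a} ta (ts {b} k t) = ts (kind-tail-succ a b k) (tree-+ ta t)
tree-+ {a} ta (tl {b} k f) =
  tl (kind-tail-lim a b k) (λ x → subst Tree (sym (fund-tail a b k x)) (tree-+ ta (f x)))

tree-times : ∀ {a} → Tree (ω^ a + 𝟎) → ∀ n → Tree (ωtimes a n)
tree-times ta zero    = ta
tree-times ta (suc n) = tree-+ ta (tree-times ta n)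

-- For a successor exponent, ω^a leads to a finite sum of copies of ω^a′, so closure under sums
-- comes first.
tree-pow : ∀ {a} → Tree a → Tree (ω^ a + 𝟎)
tree-pow tz       = ts refl tz
tree-pow (ts {a} k t) = tl (kind-pow-lim a (succ≢zer k))
  (λ x → subst Tree (sym (fund-pow-succ a k x)) (tree-times (tree-pow t) x))
tree-pow (tl {a} k f) = tl (kind-pow-lim a (lim≢zer k))
  (λ x → subst Tree (sym (fund-pow-lim a k x)) (tree-pow (f x)))

tree : ∀ a → Tree a
tree 𝟎          = tz
tree (ω^ a + b) = tree-+ (tree-pow (tree a)) (tree b)

-- The fast-growing functions

Fₜ : ∀ {a} → Tree a → ℕ → ℕ
Fₜ tz       x = suc x
Fₜ (ts k t) x = iter (Fₜ t) (suc x) x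
Fₜ (tl k f) x = Fₜ (f x) x

iter-Iter : ∀ {R f} → (∀ x → R x (f x)) → ∀ n x → Iter R n x (iter f n x)
iter-Iter r zero    x = it0
iter-Iter r (suc n) x = itS (r x) (iter-Iter r n _)

Fₜ-graph : ∀ {a} (t : Tree a) x → FG a x (Fₜ t x)
Fₜ-graph tz       x = fg0
Fₜ-graph (ts k t) x = fgSuc k (iter-Iter (Fₜ-graph t) (suc x) x)
Fₜ-graph (tl k f) x = fgLim k (Fₜ-graph (f x) x)

F : Ord → ℕ → ℕ
F a = Fₜ (tree a)

F-graph : ∀ a x → FG a x (F a x)
F-graph a = Fₜ-graph (tree a)

succ-injective : ∀ {a b k} → k ≡ succ a → k ≡ succ b → a ≡ b
succ-injective refl refl = refl

succ≢lim : ∀ {A : Set} {a k} → k ≡ succ a → k ≡ lim → A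
succ≢lim refl ()

-- Determinism of the graph frees `F` from the chosen accessibility proof: `F-succ` and `F-lim` then
-- hold without any comparison of `tree a` with the trees of its descendants.
FG-unique : ∀ {a x y z} → FG a x y → FG a x z → y ≡ z
Iter-unique : ∀ {a n x y z} → Iter (FG a) n x y → Iter (FG a) n x z → y ≡ z
FG-unique fg0         fg0          = refl
FG-unique (fgSuc k i) (fgSuc k′ j) with refl ← succ-injective k k′ = Iter-unique i j
FG-unique (fgSuc k i) (fgLim k′ _) = succ≢lim k k′
FG-unique (fgLim k _) (fgSuc k′ _) = succ≢lim k′ k
FG-unique (fgLim _ d) (fgLim _ e)  = FG-unique d e
Iter-unique it0       it0       = refl
Iter-unique (itS d i) (itS e j) with refl ← FG-unique d e = Iter-unique i j

F-value : ∀ {a x y} → FG a x y → y ≡ F a x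
F-value {a} {x} d = FG-unique d (F-graph a x)

iter-value : ∀ {a n x y} → Iter (FG a) n x y → y ≡ iter (F a) n x
iter-value {a} {n} {x} i = Iter-unique i (iter-Iter (F-graph a) n x)

F-succ : ∀ a {b} → kind a ≡ succ b → ∀ x → F a x ≡ iter (F b) (suc x) x
F-succ a {b} k x = sym (F-value {a} (fgSuc k (iter-Iter (F-graph b) (suc x) x)))

F-lim : ∀ a → kind a ≡ lim → ∀ x → F a x ≡ F (fund a x) x
F-lim a k x = sym (F-value {a} (fgLim k (F-graph (fund a x) x)))

F-infl : ∀ a → Infl (F a)
F-infl a = loop (tree a)
  where
  loop : ∀ {b} → Tree b → Infl (F b)
  loop tz x = ≤-refl
  loop (ts {b} k t) x = subst (x <_) (sym (F-succ b k x))
    (≤-trans (s≤s (m≤n+m x x)) (iter-adds (loop t) (suc x) x))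
  loop (tl {b} k f) x = subst (x <_) (sym (F-lim b k x)) (loop (f x) x)

-- Descent with `x` fixed, as in the Ketonen-Solovay relation. It compares `F` at the single
-- argument `x`, while the ordering of terms only yields eventual domination.
data Desc (x : ℕ) : Ord → Ord → Set where
  ↓refl : ∀ {a} → Desc x a a
  ↓succ : ∀ {a a′ b} → kind a ≡ succ a′ → Desc x a′ b → Desc x a b
  ↓lim : ∀ {a b} → kind a ≡ lim → Desc x (fund a x) b → Desc x a b

Desc-trans : ∀ {x a b c} → Desc x a b → Desc x b c → Desc x a c
Desc-trans ↓refl       e = e
Desc-trans (↓succ k d) e = ↓succ k (Desc-trans d e)
Desc-trans (↓lim k d) e = ↓lim k (Desc-trans d e)

Desc-𝟎 : ∀ x a → Desc x a 𝟎
Desc-𝟎 x a = loop (tree a)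
  where
  loop : ∀ {b} → Tree b → Desc x b 𝟎
  loop tz       = ↓refl
  loop (ts k t) = ↓succ k (loop t)
  loop (tl k f) = ↓lim k (loop (f x))

Desc-tail : ∀ {x b c} a → Desc x b c → Desc x (ω^ a + b) (ω^ a + c)
Desc-tail a ↓refl       = ↓refl
Desc-tail a (↓succ {b} k d) = ↓succ (kind-tail-succ a b k) (Desc-tail a d)
Desc-tail {x} a (↓lim {b} k d) = ↓lim (kind-tail-lim a b k)
  (subst (λ z → Desc x z _) (sym (fund-tail a b k x)) (Desc-tail a d))

Desc-times : ∀ x a n → Desc x (ωtimes a n) (ω^ a + 𝟎)
Desc-times x a zero    = ↓refl
Desc-times x a (suc n) = Desc-tail a (Desc-𝟎 x _)

-- For a successor exponent, ω^a becomes x + 1 copies of ω^a′, and all but the first descend to 𝟎.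
-- The +1 leaves a copy even at x = 0.
Desc-pow : ∀ {x a b} → Desc x a b → Desc x (ω^ a + 𝟎) (ω^ b + 𝟎)
Desc-pow ↓refl       = ↓refl
Desc-pow {x} (↓succ {a} {a′} k d) = ↓lim (kind-pow-lim a (succ≢zer k))
  (subst (λ z → Desc x z _) (sym (fund-pow-succ a k x))
    (Desc-trans (Desc-times x a′ x) (Desc-pow d)))
Desc-pow {x} (↓lim {a} k d) = ↓lim (kind-pow-lim a (lim≢zer k))
  (subst (λ z → Desc x z _) (sym (fund-pow-lim a k x)) (Desc-pow d))

ωtimes-Desc : ∀ x a n → Desc x (ωtimes a (suc n)) (ωtimes a n)
ωtimes-Desc x a zero    = Desc-tail a (Desc-𝟎 x _)
ωtimes-Desc x a (suc n) = Desc-tail a (ωtimes-Desc x a n)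

-- Consecutive members differ by one more summand, which descends to 𝟎, or in an exponent, to which
-- the same argument applies. This makes `F` monotone at limits.
fund-Desc : ∀ x a y → Desc x (fund a (suc y)) (fund a y)
fund-Desc x 𝟎                    y = ↓refl
fund-Desc x (ω^ a + (ω^ c + d)) y = Desc-tail a (fund-Desc x (ω^ c + d) y)
fund-Desc x (ω^ a + 𝟎) y with kind a
... | zer    = ↓refl
... | succ b = ωtimes-Desc x b y
... | lim    = Desc-pow (fund-Desc x a y)

fund-Desc-≤ : ∀ x a {y z} → y ≤ z → Desc x (fund a z) (fund a y)
fund-Desc-≤ x a {y} {z} p = subst (λ u → Desc x (fund a u) (fund a y)) (m∸n+n≡m p) (loop (z ∸ y))
  where
  loop : ∀ k → Desc x (fund a (k + y)) (fund a y)
  loop zero    = ↓refl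
  loop (suc k) = Desc-trans (fund-Desc x a (k + y)) (loop k)

F-Desc : ∀ {x a b} → Desc x a b → F b x ≤ F a x
F-Desc ↓refl = ≤-refl
F-Desc {x} {a} (↓succ {a′ = a′} k d) = ≤-trans (F-Desc d)
  (subst (F a′ x ≤_) (sym (F-succ a k x)) (iter-infl (F-infl a′) x _))
F-Desc {x} (↓lim {a} k d) = ≤-trans (F-Desc d) (≤-reflexive (sym (F-lim a k x)))

F-mono : ∀ a → Mono (F a)
F-mono a = loop (tree a)
  where
  loop : ∀ {b} → Tree b → Mono (F b)
  loop tz p = s≤s p
  loop (ts {a} {b} k t) {x} {y} p rewrite F-succ a k x | F-succ a k y =
    ≤-trans (iter-mono (loop t) (suc x) p) (iter-count (F-infl b) (s≤s p) y)
  -- Argument and index are raised separately: F_λ(x) at x is at most F_λ(x) at y, which is at most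
  -- F_λ(y) at y by descent at y.
  loop (tl {a} k f) {x} {y} p rewrite F-lim a k x | F-lim a k y =
    ≤-trans (loop (f x) p) (F-Desc (fund-Desc-≤ y a p))

extKind-zer : ∀ {a k} → extKind a k ≡ zer → k ≡ zer
extKind-zer {k = zer} _ = refl

kind-pow-≢zer : ∀ a b → kind (ω^ a + b) ≢ zer
kind-pow-≢zer 𝟎          𝟎          ()
kind-pow-≢zer (ω^ _ + _) 𝟎          ()
kind-pow-≢zer a          (ω^ c + d) k =
  kind-pow-≢zer c d (extKind-zer (trans (sym (kind-tail a c d)) k))

fund≢𝟎 : ∀ a → kind a ≡ lim → ∀ x → fund a x ≢ 𝟎
fund≢𝟎 (ω^ a + (ω^ c + d)) k x ()
fund≢𝟎 (ω^ (ω^ b + c) + 𝟎) k x eq with kind (ω^ b + c) in k′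
fund≢𝟎 (ω^ (ω^ b + c) + 𝟎) k zero    () | succ _
fund≢𝟎 (ω^ (ω^ b + c) + 𝟎) k (suc x) () | succ _
fund≢𝟎 (ω^ (ω^ b + c) + 𝟎) k x       () | lim
... | zer = ⊥-elim (kind-pow-≢zer b c k′)

F-𝟎-iter : ∀ n x → iter (F 𝟎) n x ≡ n + x
F-𝟎-iter zero    x = refl
F-𝟎-iter (suc n) x = trans (F-𝟎-iter n (suc x)) (+-suc n x)

F-double : ∀ {a} → a ≢ 𝟎 → ∀ x → x + x < F a x
F-double {a} = loop (tree a)
  where
  loop : ∀ {b} → Tree b → b ≢ 𝟎 → ∀ x → x + x < F b x
  loop tz b≢0 x = ⊥-elim (b≢0 refl)
  loop (ts {b} {𝟎} k t) b≢0 x = ≤-reflexive (sym (trans (F-succ b k x) (F-𝟎-iter (suc x) x)))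
  loop (ts {b} {ω^ c + d} k t) b≢0 x = subst (x + x <_) (sym (F-succ b k x))
    (≤-trans (loop t (λ ()) x) (iter-infl (F-infl (ω^ c + d)) x _))
  loop (tl {b} k f) b≢0 x = subst (x + x <_) (sym (F-lim b k x)) (loop (f x) (fund≢𝟎 b k x) x)

-- Domination

-- Exponents do not increase along a normal form, so the tail of `b` is bounded in the same way;
-- each leading exponent equal to `a` costs one more copy of ω^a.
<ₒ-cnf-times : ∀ a {b} → IsCNF b → LeadLE a b → Σ ℕ (λ n → b <ₒ ωtimes a n)
<ₒ-cnf-times a cnf𝟎 le = 0 , z<
<ₒ-cnf-times a (cnfω _ _ _) (inj₁ c<a) = 0 , e< c<a
<ₒ-cnf-times a (cnfω _ cb le′) (inj₂ refl) with <ₒ-cnf-times a cb le′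
... | n , b<n = suc n , t< b<n

<ₒ-pred : ∀ {a b a′} → b <ₒ a → kind a ≡ succ a′ → b ≤ₒ a′
<ₒ-pred {ω^ 𝟎 + 𝟎} z< refl = inj₂ refl
<ₒ-pred {ω^ 𝟎 + 𝟎} (e< ()) k
<ₒ-pred {ω^ 𝟎 + 𝟎} (t< ()) k
<ₒ-pred {ω^ a + (ω^ c + d)} b<a k with kind (ω^ c + d) in k′ | trans (sym (kind-tail a c d)) k
<ₒ-pred {ω^ a + (ω^ c + d)} z<     k | succ _ | refl = inj₁ z<
<ₒ-pred {ω^ a + (ω^ c + d)} (e< p) k | succ _ | refl = inj₁ (e< p)
<ₒ-pred {ω^ a + (ω^ c + d)} (t< p) k | succ _ | refl with <ₒ-pred p k′
... | inj₁ q    = inj₁ (t< q)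
... | inj₂ refl = inj₂ refl

-- Cofinality of fundamental sequences. Below ω^(a′+1) the leading exponent of `b` is at most a′,
-- and in the case of equality some multiple of ω^a′ still exceeds `b`.
<ₒ-fund : ∀ {a b} → b <ₒ a → IsCNF b → kind a ≡ lim → Σ ℕ (λ x → b <ₒ fund a x)
<ₒ-fund {ω^ a + (ω^ c + d)} z<     cb k = 0 , z<
<ₒ-fund {ω^ a + (ω^ c + d)} (e< p) cb k = 0 , e< p
<ₒ-fund {ω^ a + (ω^ c + d)} (t< p) (cnfω _ cb _) k
  with kind (ω^ c + d) in k′ | trans (sym (kind-tail a c d)) k
... | lim | _ with <ₒ-fund p cb k′
...   | x , q = x , t< q
<ₒ-fund {ω^ a + 𝟎} (t< ()) cb k
<ₒ-fund {ω^ 𝟎 + 𝟎} p cb ()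
<ₒ-fund {ω^ (ω^ a + b) + 𝟎} p cb k with kind (ω^ a + b) in k′
... | zer = ⊥-elim (kind-pow-≢zer a b k′)
<ₒ-fund {ω^ (ω^ a + b) + 𝟎} z<     cb k | succ a′ = 0 , z<
<ₒ-fund {ω^ (ω^ a + b) + 𝟎} (e< p) (cnfω _ cb le) k | succ a′ with <ₒ-pred p k′
... | inj₁ q    = 0 , e< q
... | inj₂ refl with <ₒ-cnf-times a′ cb le
...   | n , q   = suc n , t< q
<ₒ-fund {ω^ (ω^ a + b) + 𝟎} z<     cb k | lim = 0 , z<
<ₒ-fund {ω^ (ω^ a + b) + 𝟎} (e< p) (cnfω ce _ _) k | lim with <ₒ-fund p ce k′
... | x , q = x , e< q

-- Induction on accessibility: at a limit some `fund a n` lies above `b`, and for every x ≥ n the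
-- member `fund a x` descends to it.
<ₒ-Desc : ∀ {a b} → b <ₒ a → IsCNF b → Σ ℕ (λ C → ∀ {x} → C ≤ x → Desc x a b)
<ₒ-Desc {a} = loop (tree a)
  where
  loop : ∀ {a b} → Tree a → b <ₒ a → IsCNF b → Σ ℕ (λ C → ∀ {x} → C ≤ x → Desc x a b)
  loop (ts {a} k t) p cb with <ₒ-pred p k
  ... | inj₁ q with loop t q cb
  ...   | C , d = C , λ C≤x → ↓succ k (d C≤x)
  loop (ts {a} k t) p cb | inj₂ refl = 0 , λ _ → ↓succ k ↓refl
  loop (tl {a} k f) p cb with <ₒ-fund p cb k
  ... | n , q with loop (f n) q cb
  ...   | C , d = n ⊔ C , λ {x} n⊔C≤x → ↓lim k
    (Desc-trans (fund-Desc-≤ x a (m⊔n≤o⇒m≤o n C n⊔C≤x)) (d (m⊔n≤o⇒n≤o n C n⊔C≤x)))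

osuc : Ord → Ord
osuc 𝟎          = one
osuc (ω^ a + b) = ω^ a + osuc b

kind-osuc : ∀ a → kind (osuc a) ≡ succ a
kind-osuc 𝟎          = refl
kind-osuc (ω^ a + b) = kind-tail-succ a (osuc b) (kind-osuc b)

𝟎-≤ : ∀ a → 𝟎 ≤ₒ a
𝟎-≤ 𝟎          = inj₂ refl
𝟎-≤ (ω^ _ + _) = inj₁ z<

osuc-cnf : ∀ {a} → IsCNF a → IsCNF (osuc a)
osuc-cnf cnf𝟎           = cnfω cnf𝟎 cnf𝟎 _
osuc-cnf (cnfω {a} {𝟎} ca cb le)        = cnfω ca (osuc-cnf cb) (𝟎-≤ a)
osuc-cnf (cnfω {a} {ω^ _ + _} ca cb le) = cnfω ca (osuc-cnf cb) le

osuc-≤ : ∀ {a b} → b <ₒ a → osuc b ≤ₒ a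
osuc-≤ {ω^ 𝟎 + 𝟎}          z< = inj₂ refl
osuc-≤ {ω^ 𝟎 + (ω^ _ + _)} z< = inj₁ (t< z<)
osuc-≤ {ω^ (ω^ _ + _) + _} z< = inj₁ (e< z<)
osuc-≤ (e< p) = inj₁ (e< p)
osuc-≤ (t< p) with osuc-≤ p
... | inj₁ q    = inj₁ (t< q)
... | inj₂ refl = inj₂ refl

≤ₒ-Desc : ∀ {a b} → b ≤ₒ a → IsCNF b → Σ ℕ (λ C → ∀ {x} → C ≤ x → Desc x a b)
≤ₒ-Desc (inj₁ p)    cb = <ₒ-Desc p cb
≤ₒ-Desc (inj₂ refl) cb = 0 , λ _ → ↓refl

-- Through b + 1 ≤ a: F_(b+1)(x) iterates F_b x + 1 times, which is more than `m` times once x ≥ m.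
F-dominates : ∀ {a b} → b <ₒ a → IsCNF b → ∀ m →
  Σ ℕ (λ C → ∀ {x} → C ≤ x → iter (F b) m x ≤ F a x)
F-dominates {a} {b} p cb m with ≤ₒ-Desc (osuc-≤ p) (osuc-cnf cb)
... | C , d = m ⊔ C , λ {x} le →
  ≤-trans (iter-count (F-infl b) (m≤n⇒m≤1+n (m⊔n≤o⇒m≤o m C le)) x)
    (≤-trans (≤-reflexive (sym (F-succ (osuc b) (kind-osuc b) x)))
      (F-Desc (d (m⊔n≤o⇒n≤o m C le))))

-- Bounds for the functions of 𝓕

max-tabulate : ∀ {m} (f : Fin m → ℕ) {u} → (∀ i → f i ≤ u) → maxV (Vec.tabulate f) ≤ u
max-tabulate {zero}  f p = z≤n
max-tabulate {suc m} f p = ⊔-lub (p zero) (max-tabulate (λ i → f (suc i)) (λ i → p (suc i)))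

lookup≤max : ∀ {k} (v : Vec ℕ k) i → lookup v i ≤ maxV v
lookup≤max (x ∷ v) zero    = m≤m⊔n x _
lookup≤max (x ∷ v) (suc i) = ≤-trans (lookup≤max v i) (m≤n⊔m x _)

fin-bound : ∀ {m} (f : Fin m → ℕ) → Σ ℕ (λ u → ∀ i → f i ≤ u)
fin-bound f = maxV (Vec.tabulate f) , λ i →
  subst (_≤ maxV (Vec.tabulate f)) (Vec.lookup∘tabulate f i) (lookup≤max (Vec.tabulate f) i)

-- `G` is separate from `F γ` because iterates of the successor, the case γ = 𝟎, do not bound
-- addition. Composition adds iteration counts, with a maximum over the finitely many inner
-- functions; limited recursion inherits the count of its bounding function.
𝓕-bound : ∀ {γ k f} (G : ℕ → ℕ) → Mono G → Infl G →
  (∀ x → F γ x ≤ G x) → (∀ x → x + x ≤ G x) → 𝓕 γ k f →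
  Σ ℕ (λ m → ∀ v → f v ≤ iter G m (maxV v))
𝓕-bound {γ} G G-mono G-infl F≤G 2≤G = loop
  where
  loop : ∀ {k f} → 𝓕 γ k f → Σ ℕ (λ m → ∀ v → f v ≤ iter G m (maxV v))
  loop zeroF = 0 , λ _ → z≤n
  loop addF  = 1 , λ v → ≤-trans
    (+-mono-≤ (lookup≤max v zero) (lookup≤max v (suc zero))) (2≤G (maxV v))
  loop (projF i) = 0 , λ v → lookup≤max v i
  loop (fastF f g) = 1 , λ { (x ∷ []) → ≤-trans (≤-reflexive (F-value (g x)))
    (≤-trans (F≤G x) (G-mono (m≤m⊔n x 0))) }
  loop (compF gs 𝓯 𝓰) with loop 𝓯 | fin-bound (λ i → proj₁ (loop (𝓰 i)))
  ... | m , p | n , q = n + m , λ v → ≤-trans (p (Vec.tabulate (λ i → gs i v)))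
    (≤-trans (iter-mono G-mono m (max-tabulate (λ i → gs i v) (λ i →
        ≤-trans (proj₂ (loop (𝓰 i)) v) (iter-count G-infl (q i) (maxV v)))))
      (≤-reflexive (sym (iter-+ G n m (maxV v)))))
  loop (lprF r _ _ 𝓫 _ _ r≤b) with loop 𝓫
  ... | m , p = m , λ v → ≤-trans (r≤b v) (≤-trans (p (maxV v ∷ []))
    (iter-mono G-mono m (≤-reflexive (⊔-identityʳ (maxV v)))))
  loop (extF 𝓯 f≡g) with loop 𝓯
  ... | m , p = m , λ v → subst (_≤ iter G m (maxV v)) (f≡g v) (p v)

one< : ∀ {β} → two ≤ₒ β → one <ₒ β
one< (inj₁ (e< p))        = e< p
one< (inj₁ (t< (e< p)))   = t< z<
one< (inj₁ (t< (t< p)))   = t< z<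
one< (inj₂ refl)          = t< z<

𝓕<-bound : ∀ {β p} → two ≤ₒ β → 𝓕< β p → Σ Ord (λ δ → IsCNF δ × (δ <ₒ β) × (δ ≢ 𝟎) ×
  Σ ℕ (λ m → ∀ n → p n ≤ iter (F δ) m n))
𝓕<-bound {p = p} 2≤β (γ , cγ , γ<β , 𝓹) = cases γ cγ γ<β 𝓹
  where
  bound : ∀ γ δ → δ ≢ 𝟎 → (∀ x → F γ x ≤ F δ x) → 𝓕 γ 1 (λ v → p (head v)) →
    Σ ℕ (λ m → ∀ n → p n ≤ iter (F δ) m n)
  bound γ δ δ≢𝟎 le 𝓹 with 𝓕-bound (F δ) (F-mono δ) (F-infl δ) le (λ x → <⇒≤ (F-double δ≢𝟎 x)) 𝓹
  ... | m , b = m , λ n → ≤-trans (b (n ∷ [])) (≤-reflexive (cong (iter (F δ) m) (⊔-identityʳ n)))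
  cases : ∀ γ → IsCNF γ → γ <ₒ _ → 𝓕 γ 1 (λ v → p (head v)) → _
  cases 𝟎 cγ γ<β 𝓹 =
    one , cnfω cnf𝟎 cnf𝟎 _ , one< 2≤β , (λ ()) , bound 𝟎 one (λ ()) (F-infl one) 𝓹
  cases γ@(ω^ _ + _) cγ γ<β 𝓹 = γ , cγ , γ<β , (λ ()) , bound γ γ (λ ()) (λ _ → ≤-refl) 𝓹

-- Absorbing quadratic overheads into the argument of `F`

≤-by : ∀ {m n} k → n ≡ m + k → m ≤ n
≤-by {m} k refl = m≤m+n m k

quad : ℕ → ℕ → ℕ
quad K x = K * (suc x * suc x)

-- Dictated by F_2: since F_2(x) + 1 = 2^(x+1) · (x + 1) ≤ 2^(2x+1), its square times K is at most
-- 2^(4x+2+K). Written with sums alone, it is visibly in the class at index 𝟎.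
pad : ℕ → ℕ → ℕ
pad K x = ((x + x) + (x + x)) + (2 + K)

pad≤quad : ∀ {K x} → 4 ≤ K → 1 ≤ x → pad K x ≤ quad K x
pad≤quad (s≤s (s≤s (s≤s (s≤s {n = j} _)))) (s≤s {n = w} _) = ≤-by _ (identity j w)
  where
  identity : ∀ j w → (4 + j) * ((2 + w) * (2 + w)) ≡
    (((1 + w) + (1 + w)) + ((1 + w) + (1 + w))) + (2 + (4 + j)) + (j * (w * w) + 4 * (j * w) + 3 * j + 4 * (w * w) + 12 * w + 6)
  identity = solve-∀

-- The overhead moves inwards through one application at a time: what is left at an inner value is
-- `pad`, again at most `quad`, so the next application absorbs it. The number of iterations is
-- unchanged.
iter-quad : ∀ {f K} → Mono f → Infl f → 4 ≤ K → (∀ {x} → 1 ≤ x → quad K (f x) ≤ f (pad K x)) →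
  ∀ n {x} → 1 ≤ x → quad K (iter f (suc n) x) ≤ iter f (suc n) (pad K x)
iter-quad f-mono f-infl 4≤K f-quad zero    1≤x = f-quad 1≤x
iter-quad {f} f-mono f-infl 4≤K f-quad (suc n) {x} 1≤x =
  ≤-trans (iter-quad f-mono f-infl 4≤K f-quad n 1≤fx)
    (iter-mono f-mono (suc n) (≤-trans (pad≤quad 4≤K 1≤fx) (f-quad 1≤x)))
  where
  1≤fx : 1 ≤ f x
  1≤fx = ≤-trans 1≤x (<⇒≤ (f-infl x))

n<2^n : ∀ n → n < 2 ^ n
n<2^n zero    = s≤s z≤n
n<2^n (suc n) = ≤-trans (+-mono-≤ (≤-trans (s≤s z≤n) (n<2^n n)) (n<2^n n))
  (≤-reflexive (cong (2 ^ n +_) (sym (+-identityʳ (2 ^ n)))))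

F-one : ∀ x → suc (F one x) ≡ 2 * suc x
F-one x = cong suc (trans (F-𝟎-iter (suc x) x) (identity x))
  where
  identity : ∀ x → suc x + x ≡ x + suc (x + 0)
  identity = solve-∀

F-one-iter : ∀ n x → suc (iter (F one) n x) ≡ 2 ^ n * suc x
F-one-iter zero    x = sym (+-identityʳ (suc x))
F-one-iter (suc n) x = trans (F-one-iter n (F one x))
  (trans (cong (2 ^ n *_) (F-one x))
    (trans (sym (*-assoc (2 ^ n) 2 (suc x))) (cong (_* suc x) (*-comm (2 ^ n) 2))))

F-two-quad : ∀ {β} K x → kind β ≡ succ one → quad K (F β x) ≤ F β (pad K x)
F-two-quad {β} K x k =
  ≤-trans (≤-reflexive (cong (λ z → K * (z * z)) (trans (cong suc (F-succ β k x)) (F-one-iter (suc x) x))))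
    (≤-trans upper (≤-trans (≤-pred lower′) (≤-reflexive (sym (F-succ β k (pad K x))))))
  where
  open ≤-Reasoning
  E = 2 ^ suc x * suc x
  E≤ : E ≤ 2 ^ (suc x + x)
  E≤ = ≤-trans (*-monoʳ-≤ (2 ^ suc x) (n<2^n x)) (≤-reflexive (sym (^-distribˡ-+-* 2 (suc x) x)))
  exponents : ∀ K x → K + ((suc x + x) + (suc x + x)) ≡ ((x + x) + (x + x)) + (2 + K)
  exponents = solve-∀
  upper : K * (E * E) ≤ 2 ^ pad K x
  upper = begin
    K * (E * E) ≤⟨ *-mono-≤ (<⇒≤ (n<2^n K)) (*-mono-≤ E≤ E≤) ⟩
    2 ^ K * (2 ^ (suc x + x) * 2 ^ (suc x + x)) ≡⟨ cong (2 ^ K *_) (^-distribˡ-+-* 2 (suc x + x) (suc x + x)) ⟨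
    2 ^ K * 2 ^ ((suc x + x) + (suc x + x)) ≡⟨ ^-distribˡ-+-* 2 K _ ⟨
    2 ^ (K + ((suc x + x) + (suc x + x))) ≡⟨ cong (2 ^_) (exponents K x) ⟩
    2 ^ pad K x ∎
  lower : suc (2 ^ pad K x) ≤ 2 ^ suc (pad K x) * suc (pad K x)
  lower = begin
    suc (2 ^ pad K x) ≤⟨ +-monoˡ-≤ (2 ^ pad K x) (≤-trans (s≤s z≤n) (n<2^n (pad K x))) ⟩
    2 ^ pad K x + 2 ^ pad K x ≡⟨ cong (2 ^ pad K x +_) (+-identityʳ _) ⟨
    2 ^ suc (pad K x) ≡⟨ *-identityʳ _ ⟨
    2 ^ suc (pad K x) * 1 ≤⟨ *-monoʳ-≤ (2 ^ suc (pad K x)) (s≤s z≤n) ⟩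
    2 ^ suc (pad K x) * suc (pad K x) ∎

  lower′ : suc (2 ^ pad K x) ≤ suc (iter (F one) (suc (pad K x)) (pad K x))
  lower′ = ≤-trans lower (≤-reflexive (sym (F-one-iter (suc (pad K x)) (pad K x))))

NotUnit : Ord → Set
NotUnit β = (β ≢ 𝟎) × (β ≢ one)

-- The condition 1 ≤ x excludes cases such as ω(0) = 1, where F_1 could not absorb a square.
fund-NotUnit : ∀ a x → kind a ≡ lim → 1 ≤ x → NotUnit (fund a x)
fund-NotUnit a (suc x) k _ = fund≢𝟎 a k (suc x) , ≢one a k
  where
  ≢one : ∀ a → kind a ≡ lim → fund a (suc x) ≢ one
  ≢one (ω^ a + (ω^ c + d)) k eq = tail≢ (fund (ω^ c + d) (suc x)) nz eq
    where
    nz : fund (ω^ c + d) (suc x) ≢ 𝟎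
    nz with kind (ω^ c + d) in k′ | trans (sym (kind-tail a c d)) k
    ... | lim | _ = fund≢𝟎 (ω^ c + d) k′ (suc x)
    tail≢ : ∀ b → b ≢ 𝟎 → ω^ a + b ≢ one
    tail≢ 𝟎 b≢0 refl = b≢0 refl
  ≢one (ω^ (ω^ b + c) + 𝟎) k eq with kind (ω^ b + c) in k′
  ... | zer = kind-pow-≢zer b c k′
  ... | succ a′ = times≢ x eq
    where
    times≢ : ∀ n → ω^ a′ + ωtimes a′ n ≢ one
    times≢ zero    ()
    times≢ (suc n) ()
  ... | lim = pow≢ _ (fund≢𝟎 (ω^ b + c) k′ (suc x)) eq
    where
    pow≢ : ∀ e → e ≢ 𝟎 → ω^ e + 𝟎 ≢ one
    pow≢ 𝟎 e≢0 refl = e≢0 refl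

kind-one : ∀ β → kind β ≡ succ 𝟎 → β ≡ one
kind-one (ω^ 𝟎 + 𝟎) k = refl
kind-one (ω^ (ω^ _ + _) + 𝟎) ()
kind-one (ω^ a + (ω^ c + d)) k with kind (ω^ c + d) | trans (sym (kind-tail a c d)) k
... | zer    | ()
... | succ _ | ()
... | lim    | ()

unit? : ∀ δ → (δ ≡ 𝟎) ⊎ ((δ ≡ one) ⊎ NotUnit δ)
unit? 𝟎                    = inj₁ refl
unit? (ω^ 𝟎 + 𝟎)           = inj₂ (inj₁ refl)
unit? (ω^ (ω^ _ + _) + _)  = inj₂ (inj₂ ((λ ()) , (λ ())))
unit? (ω^ _ + (ω^ _ + _))  = inj₂ (inj₂ ((λ ()) , (λ ())))

-- The induction bottoms out at F_2. A larger successor combines `iter-quad` with extra iterations,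
-- from x + 1 up to `pad K x` + 1; a limit raises the index from x to `pad K x`.
F-quad : ∀ {β K} → NotUnit β → 4 ≤ K → ∀ {x} → 1 ≤ x → quad K (F β x) ≤ F β (pad K x)
F-quad {β} {K} nu 4≤K = loop (tree β) nu
  where
  x≤pad : ∀ {x} → x ≤ pad K x
  x≤pad {x} = ≤-trans (m≤m+n x x) (≤-trans (m≤m+n (x + x) (x + x)) (m≤m+n _ (2 + K)))
  loop : ∀ {β} → Tree β → NotUnit β → ∀ {x} → 1 ≤ x → quad K (F β x) ≤ F β (pad K x)
  loop tz (β≢𝟎 , _) _ = ⊥-elim (β≢𝟎 refl)
  loop (ts {β} {δ} k t) (_ , β≢1) {x} 1≤x with unit? δ
  ... | inj₁ refl        = ⊥-elim (β≢1 (kind-one β k))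
  ... | inj₂ (inj₁ refl) = F-two-quad {β} K x k
  ... | inj₂ (inj₂ nu) rewrite F-succ β k x | F-succ β k (pad K x) =
    ≤-trans (iter-quad (F-mono δ) (F-infl δ) 4≤K (loop t nu) x 1≤x)
      (iter-count (F-infl δ) {suc x} {suc (pad K x)} (s≤s x≤pad) (pad K x))
  loop (tl {β} k f) _ {x} 1≤x rewrite F-lim β k x | F-lim β k (pad K x) =
    ≤-trans (loop (f x) (fund-NotUnit β x k 1≤x) 1≤x) (F-Desc (fund-Desc-≤ _ β x≤pad))

two≤⇒NotUnit : ∀ {β} → two ≤ₒ β → NotUnit β
two≤⇒NotUnit (inj₂ refl)               = (λ ()) , (λ ())
two≤⇒NotUnit (inj₁ (e< z<))            = (λ ()) , (λ ())
two≤⇒NotUnit (inj₁ (t< (e< _)))        = (λ ()) , (λ ())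
two≤⇒NotUnit (inj₁ (t< (t< _)))        = (λ ()) , (λ ())

𝟎<two≤ : ∀ {β} → two ≤ₒ β → 𝟎 <ₒ β
𝟎<two≤ {𝟎} (inj₁ ())
𝟎<two≤ {𝟎} (inj₂ ())
𝟎<two≤ {ω^ _ + _} _ = z<

-- Membership in 𝓕 𝟎

𝓕-suc : 𝓕 𝟎 1 (λ v → suc (head v))
𝓕-suc = fastF suc (λ _ → fg0)

𝓕-suc∘ : ∀ {k f} → 𝓕 𝟎 k f → 𝓕 𝟎 k (λ v → suc (f v))
𝓕-suc∘ {f = f} 𝓯 = compF (λ _ → f) 𝓕-suc (λ _ → 𝓯)

𝓕-plus : ∀ {k f g} → 𝓕 𝟎 k f → 𝓕 𝟎 k g → 𝓕 𝟎 k (λ v → f v + g v)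
𝓕-plus {k} {f} {g} 𝓯 𝓰 = compF fg addF 𝓯𝓰
  where
  fg : Fin 2 → Vec ℕ k → ℕ
  fg zero       = f
  fg (suc zero) = g
  𝓯𝓰 : ∀ i → 𝓕 𝟎 k (fg i)
  𝓯𝓰 zero       = 𝓯
  𝓯𝓰 (suc zero) = 𝓰

𝓕-const+ : ∀ n {k f} → 𝓕 𝟎 k f → 𝓕 𝟎 k (λ v → n + f v)
𝓕-const+ zero    𝓯 = 𝓯
𝓕-const+ (suc n) 𝓯 = 𝓕-suc∘ (𝓕-const+ n 𝓯)

𝓕-head : 𝓕 𝟎 1 head
𝓕-head = extF (projF zero) (λ { (_ ∷ []) → refl })

𝓕<-const+ : ∀ {α} → 𝟎 <ₒ α → ∀ n → 𝓕< α (n +_)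
𝓕<-const+ 0<α n = 𝟎 , cnf𝟎 , 0<α , 𝓕-const+ n 𝓕-head

𝓕<-pad : ∀ {α} → 𝟎 <ₒ α → ∀ K n → 𝓕< α (λ x → pad K (n + x))
𝓕<-pad 0<α K n = 𝟎 , cnf𝟎 , 0<α , 𝓕-plus (𝓕-plus 2n 2n) (extF (𝓕-const+ (2 + K) zeroF) (λ _ → +-identityʳ (2 + K)))
  where
  2n : 𝓕 𝟎 1 (λ v → (n + head v) + (n + head v))
  2n = 𝓕-plus (𝓕-const+ n 𝓕-head) (𝓕-const+ n 𝓕-head)

-- Inclusions

module _ (M : TM) where

  runAct-mono : ∀ {m n} c {b} → m ≤ n → runAct M m c ≡ just b → runAct M n c ≡ just b
  runWith-mono : ∀ {m n} c a {b} → m ≤ n → runWith M m c a ≡ just b → runWith M n c a ≡ just b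
  runAct-mono c m≤n r = runWith-mono c (TM.δ M (Config.state c) (Config.cur c)) m≤n r
  runWith-mono c (halt b)   m≤n       r = r
  runWith-mono c (go q s m) (s≤s m≤n) r = runAct-mono _ m≤n r

decides-later : ∀ {M L} {T U : ℕ → ℕ → Set} →
  (∀ n {y} → U n y → Σ ℕ (λ z → (z ≤ y) × T n z)) → DecidesIn M T L → DecidesIn M U L
decides-later {M} earlier d w y u with earlier (length w) u
... | z , z≤y , t = runAct-mono M (initC w) z≤y (d w z t)

𝐅-step : ∀ c β → 𝐅 c β ⊆C 𝐅 (suc c) β
𝐅-step c β L (p , 𝓹 , M , d) = p , 𝓹 , M , decides-later {M} {L} earlier d
  where
  earlier : ∀ n {y} → Iter (FG β) (suc c) (p n) y → Σ ℕ (λ z → (z ≤ y) × Iter (FG β) c (p n) z)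
  earlier n {y} i = iter (F β) c (p n) ,
    ≤-trans (iter-count (F-infl β) (n≤1+n c) (p n)) (≤-reflexive (sym (iter-value i))) ,
    iter-Iter (F-graph β) c (p n)

F-majorises : ∀ {α β} → β <ₒ α → IsCNF β → ∀ m → Σ ℕ (λ C → ∀ x → iter (F β) m x ≤ F α (C + x))
F-majorises {β = β} β<α cβ m with F-dominates β<α cβ m
... | C , d = C , λ x → ≤-trans (iter-mono (F-mono β) m (m≤n+m x C)) (d (m≤m+n C x))

-- One application of F_β to a shifted argument bounds p, so the whole time bound costs c + 1
-- applications, and F_α dominates this fixed iterate.
𝐅-up : ∀ c {β α} → IsCNF β → two ≤ₒ β → β <ₒ α → 𝐅 c β ⊆C 𝐅 1 α
𝐅-up c {β} {α} cβ 2≤β β<α L (p , 𝓹 , M , d)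
  with 𝓕<-bound {p = p} 2≤β 𝓹
... | δ , cδ , δ<β , _ , m , p≤
  with F-majorises δ<β cδ m | F-majorises β<α cβ (suc c)
... | C , le | C′ , le′ = (λ n → (C′ + C) + n) , 𝓕<-const+ (𝟎< β<α) (C′ + C) , M , decides-later {M} {L} earlier d
  where
  𝟎< : ∀ {a b} → b <ₒ a → 𝟎 <ₒ a
  𝟎< z<     = z<
  𝟎< (e< _) = z<
  𝟎< (t< _) = z<
  earlier : ∀ n {y} → Iter (FG α) 1 ((C′ + C) + n) y → Σ ℕ (λ z → (z ≤ y) × Iter (FG β) c (p n) z)
  earlier n {y} i = iter (F β) c (p n) , bound , iter-Iter (F-graph β) c (p n)
    where
    open ≤-Reasoning
    bound : iter (F β) c (p n) ≤ y
    bound = begin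
      iter (F β) c (p n)           ≤⟨ iter-mono (F-mono β) c (≤-trans (p≤ n) (le n)) ⟩
      iter (F β) (suc c) (C + n)   ≤⟨ le′ (C + n) ⟩
      F α (C′ + (C + n))           ≡⟨ cong (F α) (+-assoc C′ C n) ⟨
      F α ((C′ + C) + n)           ≡⟨ iter-value i ⟨
      y                            ∎

-- Machines with finitely many stacks

data Instr (k m : ℕ) (St : Set) : Set where
  push : Fin k → Fin m → St → Instr k m St
  pop  : Fin k → (Maybe (Fin m) → St) → Instr k m St
  stop : Bool → Instr k m St

Mem : ℕ → ℕ → Set
Mem k m = Vec (List (Fin m)) k

exec : ∀ {k m St} → Instr k m St → Mem k m → Maybe (St × Mem k m)
exec (push i s q) σ = just (q , σ [ i ]≔ (s ∷ lookup σ i))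
exec (pop i f)    σ = just (f (List.head (lookup σ i)) , σ [ i ]≔ drop 1 (lookup σ i))
exec (stop b)     σ = nothing

module _ {k m : ℕ} {St : Set} (P : St → Instr k m St) where

  data Reach : ℕ → St × Mem k m → St × Mem k m → Set where
    done : ∀ {t c} → Reach t c c
    step : ∀ {t q σ c c′} → exec (P q) σ ≡ just c → Reach t c c′ → Reach (suc t) (q , σ) c′

  data Halts : ℕ → St × Mem k m → Bool → Set where
    stop : ∀ {t q σ b} → P q ≡ stop b → Halts t (q , σ) b
    step : ∀ {t q σ c b} → exec (P q) σ ≡ just c → Halts t c b → Halts (suc t) (q , σ) b

  reach-weaken : ∀ {s t c c′} → s ≤ t → Reach s c c′ → Reach t c c′
  reach-weaken s≤t       done       = done
  reach-weaken (s≤s s≤t) (step e r) = step e (reach-weaken s≤t r)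

  infixr 5 _⟫_ _⟫ₕ_

  _⟫_ : ∀ {s t c c′ c″} → Reach s c c′ → Reach t c′ c″ → Reach (s + t) c c″
  _⟫_ {s} {t} done r = reach-weaken (m≤n+m t s) r
  step e r ⟫ r′ = step e (r ⟫ r′)

  halts-weaken : ∀ {s t c b} → s ≤ t → Halts s c b → Halts t c b
  halts-weaken s≤t       (stop e)   = stop e
  halts-weaken (s≤s s≤t) (step e h) = step e (halts-weaken s≤t h)

  _⟫ₕ_ : ∀ {s t c c′ b} → Reach s c c′ → Halts t c′ b → Halts (s + t) c b
  _⟫ₕ_ {s} {t} done h = halts-weaken (m≤n+m t s) h
  step e r ⟫ₕ h = step e (r ⟫ₕ h)

-- Finite types as state sets

record Finite (A : Set) : Set where
  field
    card    : ℕ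
    index     : A → Fin card
    element     : Fin card → A
    element-index : ∀ a → element (index a) ≡ a

open Finite

finite-Fin : ∀ n → Finite (Fin n)
finite-Fin n = record { card = n ; index = λ i → i ; element = λ i → i ; element-index = λ _ → refl }

finite-retract : ∀ {A B : Set} → Finite B → (f : A → B) (g : B → A) → (∀ a → g (f a) ≡ a) → Finite A
finite-retract fin f g gf = record
  { card = card fin ; index = λ a → index fin (f a) ; element = λ i → g (element fin i)
  ; element-index = λ a → trans (cong g (element-index fin (f a))) (gf a) }

finite-× : ∀ {A B : Set} → Finite A → Finite B → Finite (A × B)
finite-× finA finB = record
  { card = card finA * card finB
  ; index = λ p → combine (index finA (proj₁ p)) (index finB (proj₂ p))
  ; element = λ i → element finA (proj₁ (remQuot (card finB) i)) , element finB (proj₂ (remQuot {card finA} (card finB) i))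
  ; element-index = λ p → trans
      (cong (λ r → element finA (proj₁ r) , element finB (proj₂ r))
        (Fin.remQuot-combine (index finA (proj₁ p)) (index finB (proj₂ p))))
      (cong₂ _,_ (element-index finA (proj₁ p)) (element-index finB (proj₂ p))) }

finite-⊎ : ∀ {A B : Set} → Finite A → Finite B → Finite (A ⊎ B)
finite-⊎ {A} {B} finA finB = record
  { card = card finA + card finB
  ; index = λ s → join (card finA) (card finB) (map⊎ (index finA) (index finB) s)
  ; element = λ i → map⊎ (element finA) (element finB) (splitAt (card finA) i)
  ; element-index = λ s → trans
      (cong (map⊎ (element finA) (element finB)) (Fin.splitAt-join (card finA) (card finB) (map⊎ (index finA) (index finB) s)))
      (back s) }
  where
  back : ∀ s → map⊎ (element finA) (element finB) (map⊎ (index finA) (index finB) s) ≡ s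
  back (inj₁ a) = cong inj₁ (element-index finA a)
  back (inj₂ b) = cong inj₂ (element-index finB b)

-- Runs of Turing machines

module _ (M : TM) where
  open TM M

  data Run : ℕ → Config Q G → Config Q G → Set where
    done : ∀ {t c} → Run t c c
    step : ∀ {t p ls c rs q s m c′} → δ p c ≡ go q s m →
           Run t (moveC m q ls s rs) c′ → Run (suc t) (cfg p ls c rs) c′

  run-weaken : ∀ {s t c c′} → s ≤ t → Run s c c′ → Run t c c′
  run-weaken s≤t       done       = done
  run-weaken (s≤s s≤t) (step e r) = step e (run-weaken s≤t r)

  run-runAct : ∀ {t c c′ B b} → Run t c c′ →
    (∀ {y} → B ≤ y → runAct M y c′ ≡ just b) → ∀ {y} → t + B ≤ y → runAct M y c ≡ just b
  run-runAct {t} {B = B} done k le = k (≤-trans (m≤n+m B t) le)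
  run-runAct (step e r) k {suc y} (s≤s le) rewrite e = run-runAct r k le

-- A stack is stored on a track of the tape, bottom cell first, to the
-- right of a home cell to which the head returns between instructions.

fromOpt : ∀ {n} → Maybe (Fin n) → Fin (suc n)
fromOpt nothing  = zero
fromOpt (just s) = suc s

toOpt : ∀ {n} → Fin (suc n) → Maybe (Fin n)
toOpt zero    = nothing
toOpt (suc s) = just s

toOpt-fromOpt : ∀ {n} (o : Maybe (Fin n)) → toOpt (fromOpt o) ≡ o
toOpt-fromOpt nothing  = refl
toOpt-fromOpt (just _) = refl

bit : ∀ {m} → Bool → Fin (2 + m)
bit false = zero
bit true  = suc zero

-- From stack machines to single-tape machines

module Compile {k m : ℕ} (inp : Fin k) {St : Set} (fin : Finite St)
  (P : St → Instr k (2 + m) St) (q₀ : St) where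

  open Finite fin using () renaming (card to card₀; index to enc₀; element to dec₀; element-index to dec-enc₀)

  Sym : Set
  Sym = Fin (2 + m)

  -- Besides blank and the two input letters there are `home` and one symbol for each assignment of
  -- an optional stack symbol, with 3 + m values, to the `k` tracks.
  G′ : ℕ
  G′ = suc ((3 + m) ^ k)

  Code : Set
  Code = Fin (3 + G′)

  pattern home = suc (suc (suc zero))

  inputTrack : Sym → Fin k → Maybe Sym
  inputTrack s = updateAt (const nothing) inp (const (just s))

  -- Blanks and raw input letters already count as cells, so the input is a stack as it stands, with
  -- its first letter at the bottom.
  track : Code → Fin k → Maybe Sym
  track zero                      = const nothing
  track (suc zero)                = inputTrack zero
  track (suc (suc zero))          = inputTrack (suc zero)
  track home                      = const nothing
  track (suc (suc (suc (suc j)))) = toOpt ∘ finToFun j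

  isHome : Code → Bool
  isHome home = true
  isHome _    = false

  cell : (Fin k → Maybe Sym) → Code
  cell t = suc (suc (suc (suc (funToFin (fromOpt ∘ t)))))

  track-cell : ∀ t i → track (cell t) i ≡ t i
  track-cell t i = trans (cong toOpt (Fin.finToFun-funToFin (fromOpt ∘ t) i)) (toOpt-fromOpt (t i))

  setTrack : Code → Fin k → Maybe Sym → Code
  setTrack c i x = cell (updateAt (track c) i (const x))

  track-set : ∀ c i x → track (setTrack c i x) i ≡ x
  track-set c i x = trans (track-cell _ i) (VF.updateAt-updates i (track c))

  track-set-≢ : ∀ c {i j} x → j ≢ i → track (setTrack c i x) j ≡ track c j
  track-set-≢ c {i} {j} x j≢i = trans (track-cell _ j) (VF.updateAt-minimal j i (track c) j≢i)

  -- `boot` and `mark` create the home cell left of the input. `ret` runs left to it, `seek` runs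
  -- right to the first cell that is free on the relevant track, and `take` stands one cell left of
  -- that, on the top of the stack.
  data Ctl : Set where
    boot mark     : Ctl
    ret seek take : St → Ctl

  Q′ : ℕ
  Q′ = suc (3 * card₀)

  encC : Ctl → Fin (suc Q′)
  encC boot     = zero
  encC mark     = suc zero
  encC (ret q)  = suc (suc (combine {3} zero (enc₀ q)))
  encC (seek q) = suc (suc (combine {3} (suc zero) (enc₀ q)))
  encC (take q) = suc (suc (combine {3} (suc (suc zero)) (enc₀ q)))

  tagged : Fin 3 × Fin card₀ → Ctl
  tagged (zero           , i) = ret (dec₀ i)
  tagged (suc zero       , i) = seek (dec₀ i)
  tagged (suc (suc zero) , i) = take (dec₀ i)

  decC : Fin (suc Q′) → Ctl
  decC zero          = boot
  decC (suc zero)    = mark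
  decC (suc (suc i)) = tagged (remQuot card₀ i)

  dec-encC : ∀ c → decC (encC c) ≡ c
  dec-encC boot     = refl
  dec-encC mark     = refl
  dec-encC (ret q)  = trans (cong tagged (Fin.remQuot-combine {3} zero (enc₀ q))) (cong ret (dec-enc₀ q))
  dec-encC (seek q) = trans (cong tagged (Fin.remQuot-combine {3} (suc zero) (enc₀ q))) (cong seek (dec-enc₀ q))
  dec-encC (take q) = trans (cong tagged (Fin.remQuot-combine {3} (suc (suc zero)) (enc₀ q))) (cong take (dec-enc₀ q))

  Act : Set
  Act = Action Q′ G′

  goto : Ctl → Code → Move → Act
  goto c = go (encC c)

  retAct : St → Code → Bool → Instr k (2 + m) St → Act
  retAct q c false _          = goto (ret q) c mL
  retAct q c true  (stop b)   = halt b
  retAct q c true  (push _ _ _) = goto (seek q) c mR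
  retAct q c true  (pop _ _)  = goto (seek q) c mR

  pushAct : St → Code → Fin k → Sym → St → Maybe Sym → Act
  pushAct q c i s q′ nothing  = goto (ret q′) (setTrack c i (just s)) mL
  pushAct q c i s q′ (just _) = goto (seek q) c mR

  popAct : St → Code → Maybe Sym → Act
  popAct q c nothing  = goto (take q) c mL
  popAct q c (just _) = goto (seek q) c mR

  seekAct : St → Code → Instr k (2 + m) St → Act
  seekAct q c (push i s q′) = pushAct q c i s q′ (track c i)
  seekAct q c (pop i f)     = popAct q c (track c i)
  seekAct q c (stop b)      = halt b

  takeAct : Code → Fin k → (Maybe Sym → St) → Bool → Act
  -- Stepping back from the first free cell onto `home` means that the stack was empty.
  takeAct c i f true  = goto (ret (f nothing)) c mS
  takeAct c i f false = goto (ret (f (track c i))) (setTrack c i nothing) mL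

  takeInstr : Code → Instr k (2 + m) St → Act
  takeInstr c (pop i f)    = takeAct c i f (isHome c)
  takeInstr c (push _ _ _) = halt false
  takeInstr c (stop b)     = halt b

  act : Ctl → Code → Act
  act boot     c = goto mark c mL
  act mark     c = goto (ret q₀) home mS
  act (ret q)  c = retAct q c (isHome c) (P q)
  act (seek q) c = seekAct q c (P q)
  act (take q) c = takeInstr c (P q)

  M : TM
  M = record { Q = Q′ ; G = G′ ; δ = λ p → act (decC p) }

  Cfg : Set
  Cfg = Config Q′ G′

  step′ : ∀ {t ls c rs s mv c′} p q → act p c ≡ goto q s mv →
    Run M t (moveC mv (encC q) ls s rs) c′ → Run M (suc t) (cfg (encC p) ls c rs) c′
  step′ {c = c} p q e = step (trans (cong (λ x → act x c) (dec-encC p)) e)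

  atCells : Ctl → List Code → List Code → Cfg
  atCells p ls []       = cfg (encC p) ls blank []
  atCells p ls (r ∷ rs) = cfg (encC p) ls r rs

  moveR-atCells : ∀ p ls c rs → moveC mR (encC p) ls c rs ≡ atCells p (c ∷ ls) rs
  moveR-atCells p ls c []       = refl
  moveR-atCells p ls c (_ ∷ rs) = refl

  homeC : St → List Code → Cfg
  homeC q rs = cfg (encC (ret q)) [] home rs

  Plain : Code → Set
  Plain c = isHome c ≡ false

  run-back : ∀ q ls c rs → All Plain ls →
    Run M (length ls) (moveC mL (encC (ret q)) (ls ∷ʳ home) c rs) (homeC q (ls ʳ++ (c ∷ rs)))
  run-back q []       c rs []       = done
  run-back q (l ∷ ls) c rs (p ∷ ps) =
    step′ (ret q) (ret q) (cong (λ h → retAct q l h (P q)) p) (run-back q ls l (c ∷ rs) ps)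

  pushCells : Fin k → Sym → List Code → List Code
  pushCells′ : Fin k → Sym → Code → List Code → Maybe Sym → List Code
  pushCells i s []       = setTrack blank i (just s) ∷ []
  pushCells i s (c ∷ cs) = pushCells′ i s c cs (track c i)
  pushCells′ i s c cs nothing  = setTrack c i (just s) ∷ cs
  pushCells′ i s c cs (just _) = c ∷ pushCells i s cs

  run-push : ∀ {q i s q′} → P q ≡ push i s q′ → ∀ ls rs → All Plain ls → All Plain rs →
    Run M (1 + (length ls + 2 * length rs)) (atCells (seek q) (ls ∷ʳ home) rs)
      (homeC q′ (ls ʳ++ pushCells i s rs))
  run-push {q} {i} {s} {q′} eq ls [] pls [] =
    step′ (seek q) (ret q′) (cong (seekAct q blank) eq)
      (run-weaken M (m≤m+n _ _) (run-back q′ ls _ [] pls))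
  run-push {q} {i} {s} {q′} eq ls (c ∷ cs) pls (pc ∷ pcs) with track c i in tr
  ... | nothing = step′ (seek q) (ret q′) (trans (cong (seekAct q c) eq) (cong (pushAct q c i s q′) tr))
      (run-weaken M (m≤m+n _ _) (run-back q′ ls _ cs pls))
  ... | just _  = step′ (seek q) (seek q) (trans (cong (seekAct q c) eq) (cong (pushAct q c i s q′) tr))
      (subst₂ (λ t z → Run M t z (homeC q′ (ls ʳ++ (c ∷ pushCells i s cs))))
        (cost (length ls) (length cs)) (sym (moveR-atCells (seek q) (ls ∷ʳ home) c cs))
        (run-push eq (c ∷ ls) cs (pc ∷ pls) pcs))
    where
    cost : ∀ a b → 1 + (suc a + 2 * b) ≡ a + 2 * (suc b)
    cost = solve-∀

  -- `p` is the occupied cell just passed: it is recognised as the top only once the cell to its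
  -- right is seen to be free.
  popFrom : Fin k → Code → List Code → Maybe Sym × List Code
  popFrom′ : Fin k → Code → Code → List Code → Maybe Sym → Maybe Sym × List Code
  popFrom i p []       = track p i , setTrack p i nothing ∷ blank ∷ []
  popFrom i p (c ∷ cs) = popFrom′ i p c cs (track c i)
  popFrom′ i p c cs nothing  = track p i , setTrack p i nothing ∷ c ∷ cs
  popFrom′ i p c cs (just _) = proj₁ (popFrom i c cs) , p ∷ proj₂ (popFrom i c cs)

  run-take : ∀ {q i f} → P q ≡ pop i f → ∀ p ls rs → All Plain ls → Plain p →
    Run M (1 + length ls) (cfg (encC (take q)) (ls ∷ʳ home) p rs)
      (homeC (f (track p i)) (ls ʳ++ (setTrack p i nothing ∷ rs)))
  run-take {q} {i} {f} eq p ls rs pls pp =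
    step′ (take q) (ret (f (track p i))) (trans (cong (takeInstr p) eq) (cong (takeAct p i f) pp))
      (run-back _ ls _ rs pls)

  run-popFrom : ∀ {q i f} → P q ≡ pop i f → ∀ p ls rs → All Plain ls → Plain p → All Plain rs →
    Run M (2 + (length ls + 2 * length rs)) (atCells (seek q) (p ∷ ls ∷ʳ home) rs)
      (homeC (f (proj₁ (popFrom i p rs))) (ls ʳ++ proj₂ (popFrom i p rs)))
  run-popFrom {q} {i} {f} eq p ls [] pls pp [] =
    step′ (seek q) (take q) (cong (seekAct q blank) eq)
      (run-weaken M (s≤s (m≤m+n _ _)) (run-take eq p ls (blank ∷ []) pls pp))
  run-popFrom {q} {i} {f} eq p ls (c ∷ cs) pls pp (pc ∷ pcs) with track c i in tr
  ... | nothing = step′ (seek q) (take q) (trans (cong (seekAct q c) eq) (cong (popAct q c) tr))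
      (run-weaken M (s≤s (m≤m+n _ _)) (run-take eq p ls (c ∷ cs) pls pp))
  ... | just _  = step′ (seek q) (seek q) (trans (cong (seekAct q c) eq) (cong (popAct q c) tr))
      (subst₂ (λ t z → Run M t z (homeC (f (proj₁ (popFrom i c cs))) (ls ʳ++ (p ∷ proj₂ (popFrom i c cs)))))
        (cost (length ls) (length cs)) (sym (moveR-atCells (seek q) (p ∷ ls ∷ʳ home) c cs))
        (run-popFrom eq c (p ∷ ls) cs (pp ∷ pls) pc pcs))
    where
    cost : ∀ a b → 2 + (suc a + 2 * b) ≡ 1 + (a + 2 * (suc b))
    cost = solve-∀

  popCells : Fin k → List Code → Maybe Sym × List Code
  popCells′ : Fin k → Code → List Code → Maybe Sym → Maybe Sym × List Code
  popCells i []       = nothing , blank ∷ []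
  popCells i (c ∷ cs) = popCells′ i c cs (track c i)
  popCells′ i c cs nothing  = nothing , c ∷ cs
  popCells′ i c cs (just _) = popFrom i c cs

  run-pop : ∀ {q i f} → P q ≡ pop i f → ∀ rs → All Plain rs →
    Run M (2 + 2 * length rs) (atCells (seek q) (home ∷ []) rs)
      (homeC (f (proj₁ (popCells i rs))) (proj₂ (popCells i rs)))
  run-pop {q} {i} {f} eq [] [] =
    step′ (seek q) (take q) (cong (seekAct q blank) eq)
      (step′ (take q) (ret (f nothing)) (cong (takeInstr home) eq) done)
  run-pop {q} {i} {f} eq (c ∷ cs) (pc ∷ pcs) with track c i in tr
  ... | nothing = step′ (seek q) (take q) (trans (cong (seekAct q c) eq) (cong (popAct q c) tr))
      (step′ (take q) (ret (f nothing)) (cong (takeInstr home) eq) done)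
  ... | just _  = step′ (seek q) (seek q) (trans (cong (seekAct q c) eq) (cong (popAct q c) tr))
      (subst (λ z → Run M (1 + 2 * suc (length cs)) z _) (sym (moveR-atCells (seek q) (home ∷ []) c cs))
        (run-weaken M (cost (length cs)) (run-popFrom eq c [] cs [] pc pcs)))
    where
    identity : ∀ b → 3 + 2 * b ≡ 1 + 2 * suc b
    identity = solve-∀
    cost : ∀ b → 2 + 2 * b ≤ 1 + 2 * suc b
    cost b = ≤-trans (n≤1+n _) (≤-reflexive (identity b))

  Empty : Fin k → List Code → Set
  Empty i = All (λ c → track c i ≡ nothing)

  data Holds (i : Fin k) : List Code → List Sym → Set where
    empty : ∀ {cs} → Empty i cs → Holds i cs []
    cons  : ∀ {c cs x xs} → track c i ≡ just x → Holds i cs xs → Holds i (c ∷ cs) (x ∷ xs)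

  -- Work on one stack may lengthen the tape, so the other tracks are preserved only up to empty
  -- cells at the end.
  data SameTrack (i : Fin k) : List Code → List Code → Set where
    extend : ∀ {cs} → Empty i cs → SameTrack i [] cs
    keep   : ∀ {cs} → SameTrack i cs cs
    cons   : ∀ {c d cs ds} → track d i ≡ track c i → SameTrack i cs ds → SameTrack i (c ∷ cs) (d ∷ ds)

  same-Empty : ∀ {i cs ds} → Empty i cs → SameTrack i cs ds → Empty i ds
  same-Empty []       (extend e) = e
  same-Empty es       keep       = es
  same-Empty (e ∷ es) (cons p s) = trans p e ∷ same-Empty es s

  same-Holds : ∀ {i cs ds xs} → Holds i cs xs → SameTrack i cs ds → Holds i ds xs
  same-Holds (empty es)  s          = empty (same-Empty es s)
  same-Holds h           keep       = h
  same-Holds (cons e h)  (cons p s) = cons (trans p e) (same-Holds h s)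

  push-Holds : ∀ {i cs xs} s → Holds i cs xs → Holds i (pushCells i s cs) (xs ∷ʳ s)
  push-Holds {i} s (empty [])               = cons (track-set blank i (just s)) (empty [])
  push-Holds {i} s (empty (_∷_ {c} e es)) rewrite e = cons (track-set c i (just s)) (empty es)
  push-Holds {i} s (cons e h) rewrite e = cons e (push-Holds s h)

  push-same : ∀ {i j} → j ≢ i → ∀ s cs → SameTrack j cs (pushCells i s cs)
  push-same         j≢i s []       = extend (track-set-≢ blank (just s) j≢i ∷ [])
  push-same {i} {j} j≢i s (c ∷ cs) with track c i
  ... | nothing = cons (track-set-≢ c (just s) j≢i) keep
  ... | just _  = cons refl (push-same j≢i s cs)

  popFrom-Holds : ∀ {i p cs} xs {s} → Holds i (p ∷ cs) (xs ∷ʳ s) →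
    (proj₁ (popFrom i p cs) ≡ just s) × Holds i (proj₂ (popFrom i p cs)) xs
  popFrom-Holds {i} {p} {[]}     [] (cons e (empty _)) = e , empty (track-set p i nothing ∷ refl ∷ [])
  popFrom-Holds {i} {p} {c ∷ cs} [] (cons e (empty (e′ ∷ es))) rewrite e′ =
    e , empty (track-set p i nothing ∷ e′ ∷ es)
  popFrom-Holds {i} {p} {[]}     (x ∷ [])     (cons e ())
  popFrom-Holds {i} {p} {[]}     (x ∷ y ∷ xs) (cons e ())
  popFrom-Holds {i} {p} {c ∷ cs} (x ∷ xs) (cons e h) with track c i in tr
  ... | just _ = proj₁ (popFrom-Holds xs h) , cons e (proj₂ (popFrom-Holds xs h))
  popFrom-Holds {i} {p} {c ∷ cs} (x ∷ []) (cons e (cons e′ h)) | nothing with () ← trans (sym tr) e′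
  popFrom-Holds {i} {p} {c ∷ cs} (x ∷ y ∷ xs) (cons e (cons e′ h)) | nothing with () ← trans (sym tr) e′

  popFrom-same : ∀ {i j} → j ≢ i → ∀ p cs → SameTrack j (p ∷ cs) (proj₂ (popFrom i p cs))
  popFrom-same         j≢i p []       = cons (track-set-≢ p nothing j≢i) (extend (refl ∷ []))
  popFrom-same {i} {j} j≢i p (c ∷ cs) with track c i
  ... | nothing = cons (track-set-≢ p nothing j≢i) keep
  ... | just _  = cons refl (popFrom-same j≢i c cs)

  pop-Holds : ∀ {i cs} xs → Holds i cs (reverse xs) →
    (proj₁ (popCells i cs) ≡ List.head xs) × Holds i (proj₂ (popCells i cs)) (reverse (drop 1 xs))
  pop-Holds {i} {[]}     [] (empty [])       = refl , empty (refl ∷ [])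
  pop-Holds {i} {c ∷ cs} [] (empty (e ∷ es)) rewrite e = refl , empty (e ∷ es)
  pop-Holds {i} {cs} (x ∷ xs) h =
    fromBottom cs (reverse xs) (subst (Holds i cs) (List.unfold-reverse x xs) h)
    where
    fromBottom : ∀ cs ys → Holds i cs (ys ∷ʳ x) →
      (proj₁ (popCells i cs) ≡ just x) × Holds i (proj₂ (popCells i cs)) ys
    fromBottom (c ∷ cs) []       h@(cons e _) rewrite e = popFrom-Holds [] h
    fromBottom (c ∷ cs) (y ∷ ys) h@(cons e _) rewrite e = popFrom-Holds (y ∷ ys) h

  pop-same : ∀ {i j} → j ≢ i → ∀ cs → SameTrack j cs (proj₂ (popCells i cs))
  pop-same     j≢i []       = extend (refl ∷ [])
  pop-same {i} j≢i (c ∷ cs) with track c i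
  ... | nothing = keep
  ... | just _  = popFrom-same j≢i c cs

  push-plain : ∀ i s {cs} → All Plain cs → All Plain (pushCells i s cs)
  push-plain i s []       = refl ∷ []
  push-plain i s (_∷_ {c} p ps) with track c i
  ... | nothing = refl ∷ ps
  ... | just _  = p ∷ push-plain i s ps

  popFrom-plain : ∀ i {p cs} → Plain p → All Plain cs → All Plain (proj₂ (popFrom i p cs))
  popFrom-plain i pp []       = refl ∷ refl ∷ []
  popFrom-plain i pp (_∷_ {c} pc ps) with track c i
  ... | nothing = refl ∷ pc ∷ ps
  ... | just _  = pp ∷ popFrom-plain i pc ps

  pop-plain : ∀ i {cs} → All Plain cs → All Plain (proj₂ (popCells i cs))
  pop-plain i []       = refl ∷ []
  pop-plain i (_∷_ {c} p ps) with track c i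
  ... | nothing = p ∷ ps
  ... | just _  = popFrom-plain i p ps

  push-length : ∀ i s cs → length (pushCells i s cs) ≤ suc (length cs)
  push-length i s []       = ≤-refl
  push-length i s (c ∷ cs) with track c i
  ... | nothing = n≤1+n _
  ... | just _  = s≤s (push-length i s cs)

  popFrom-length : ∀ i p cs → length (proj₂ (popFrom i p cs)) ≤ 2 + length cs
  popFrom-length i p []       = ≤-refl
  popFrom-length i p (c ∷ cs) with track c i
  ... | nothing = n≤1+n _
  ... | just _  = s≤s (popFrom-length i c cs)

  pop-length : ∀ i cs → length (proj₂ (popCells i cs)) ≤ suc (length cs)
  pop-length i []       = ≤-refl
  pop-length i (c ∷ cs) with track c i
  ... | nothing = n≤1+n _
  ... | just _  = popFrom-length i c cs

  -- Simulation of the stack machine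

  record Represents (rs : List Code) (σ : Mem k (2 + m)) : Set where
    constructor rep
    field
      plain : All Plain rs
      holds : ∀ i → Holds i rs (reverse (lookup σ i))

  open Represents

  push-rep : ∀ {rs σ} i s → Represents rs σ → Represents (pushCells i s rs) (σ [ i ]≔ (s ∷ lookup σ i))
  push-rep {rs} {σ} i s r = rep (push-plain i s (plain r)) on
    where
    on : ∀ j → Holds j (pushCells i s rs) (reverse (lookup (σ [ i ]≔ (s ∷ lookup σ i)) j))
    on j with j Fin.≟ i
    ... | yes refl rewrite Vec.lookup∘update i σ (s ∷ lookup σ i) | List.unfold-reverse s (lookup σ i) =
      push-Holds s (holds r i)
    ... | no j≢i rewrite Vec.lookup∘update′ j≢i σ (s ∷ lookup σ i) =
      same-Holds (holds r j) (push-same j≢i s rs)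

  pop-rep : ∀ {rs σ} i → Represents rs σ →
    Represents (proj₂ (popCells i rs)) (σ [ i ]≔ drop 1 (lookup σ i))
  pop-rep {rs} {σ} i r = rep (pop-plain i (plain r)) on
    where
    on : ∀ j → Holds j (proj₂ (popCells i rs)) (reverse (lookup (σ [ i ]≔ drop 1 (lookup σ i)) j))
    on j with j Fin.≟ i
    ... | yes refl rewrite Vec.lookup∘update i σ (drop 1 (lookup σ i)) =
      proj₂ (pop-Holds (lookup σ i) (holds r i))
    ... | no j≢i rewrite Vec.lookup∘update′ j≢i σ (drop 1 (lookup σ i)) =
      same-Holds (holds r j) (pop-same j≢i rs)

  record Simulated (rs : List Code) (q : St) (c : St × Mem k (2 + m)) : Set where
    field
      rs′    : List Code
      rep′   : Represents rs′ (proj₂ c)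
      short  : length rs′ ≤ suc (length rs)
      run    : Run M (2 * length rs + 3) (homeC q rs) (homeC (proj₁ c) rs′)

  simulate : ∀ {rs q σ c} → Represents rs σ → exec (P q) σ ≡ just c → Simulated rs q c
  simulate {rs} {q} {σ} r eq with P q in pq
  simulate {rs} {q} {σ} r refl | push i s q′ = record
    { rs′ = pushCells i s rs ; rep′ = push-rep i s r ; short = push-length i s rs
    ; run = run-weaken M (≤-trans (n≤1+n _) (≤-reflexive (+-comm 3 (2 * length rs))))
        (step′ (ret q) (seek q) (cong (retAct q home true) pq)
          (subst (λ z → Run M _ z _) (sym (moveR-atCells (seek q) [] home rs))
            (run-push pq [] rs [] (plain r)))) }
  simulate {rs} {q} {σ} r refl | pop i f = record
    { rs′ = proj₂ (popCells i rs) ; rep′ = pop-rep i r ; short = pop-length i rs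
    ; run = run-weaken M (≤-reflexive (+-comm 3 (2 * length rs)))
        (step′ (ret q) (seek q) (cong (retAct q home true) pq)
          (subst₂ (λ z x → Run M _ z (homeC (f x) _)) (sym (moveR-atCells (seek q) [] home rs))
            (proj₁ (pop-Holds (lookup σ i) (holds r i)))
            (run-pop pq rs (plain r)))) }

  -- An instruction adds at most one cell to the tape, so each of the t round trips costs at most 2
  -- · (length rs + t) + 3 moves.
  simulate-halts : ∀ {t rs q σ b} → Represents rs σ → Halts P t (q , σ) b →
    ∀ {y} → t * (2 * (length rs + t) + 3) ≤ y → runAct M y (homeC q rs) ≡ just b
  simulate-halts {rs = rs} {q} {b = b} r (stop eq) {y} _
    rewrite dec-encC (ret q) | eq = refl
  simulate-halts {suc t} {rs} r (step eq h) {y} le =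
    run-runAct M run (λ {z} → simulate-halts rep′ h {z}) (≤-trans bound le)
    where
    open Simulated (simulate r eq)
    bound : (2 * length rs + 3) + t * (2 * (length rs′ + t) + 3) ≤ suc t * (2 * (length rs + suc t) + 3)
    bound = +-mono-≤
      (+-monoˡ-≤ 3 (*-monoʳ-≤ 2 (m≤m+n (length rs) (suc t))))
      (*-monoʳ-≤ t (+-monoˡ-≤ 3 (*-monoʳ-≤ 2
        (≤-trans (+-monoˡ-≤ t short) (≤-reflexive (sym (+-suc (length rs) t)))))))

  σ₀ : List Bool → Mem k (2 + m)
  σ₀ w = Vec.replicate k [] [ inp ]≔ reverse (map bit w)

  input-plain : ∀ w → All Plain (map inSym w)
  input-plain []          = []
  input-plain (false ∷ w) = refl ∷ input-plain w
  input-plain (true ∷ w)  = refl ∷ input-plain w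

  track-input : ∀ b → track (inSym b) inp ≡ just (bit b)
  track-input false = VF.updateAt-updates inp (const nothing)
  track-input true  = VF.updateAt-updates inp (const nothing)

  track-input-≢ : ∀ {i} b → i ≢ inp → track (inSym b) i ≡ nothing
  track-input-≢ {i} false i≢inp = VF.updateAt-minimal i inp (const nothing) i≢inp
  track-input-≢ {i} true  i≢inp = VF.updateAt-minimal i inp (const nothing) i≢inp

  input-rep : ∀ w → Represents (map inSym w) (σ₀ w)
  input-rep w = rep (input-plain w) on
    where
    on-inp : ∀ w → Holds inp (map inSym w) (map bit w)
    on-inp []      = empty []
    on-inp (b ∷ w) = cons (track-input b) (on-inp w)
    off-inp : ∀ {i} → i ≢ inp → ∀ w → Empty i (map inSym w)
    off-inp i≢inp []      = []
    off-inp i≢inp (b ∷ w) = track-input-≢ b i≢inp ∷ off-inp i≢inp w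
    on : ∀ i → Holds i (map inSym w) (reverse (lookup (σ₀ w) i))
    on i with i Fin.≟ inp
    ... | yes refl rewrite Vec.lookup∘update inp (Vec.replicate k []) (reverse (map (bit {m}) w))
                   | List.reverse-involutive (map (bit {m}) w) = on-inp w
    ... | no i≢inp rewrite Vec.lookup∘update′ i≢inp (Vec.replicate k []) (reverse (map (bit {m}) w))
                   | Vec.lookup-replicate {n = k} i (List.List.[] {A = Sym}) = empty (off-inp i≢inp w)

  -- On the empty word the head starts on a blank, which `boot` leaves as a cell to the right of
  -- `home`.
  blank-rep : Represents (blank ∷ []) (σ₀ [])
  blank-rep = rep (refl ∷ []) (λ i → same-Holds (holds (input-rep []) i) (extend (refl ∷ [])))

  compile-halts : ∀ {t b} w → Halts P t (q₀ , σ₀ w) b →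
    ∀ {y} → 2 + t * (2 * (suc (length w) + t) + 3) ≤ y → runAct M y (initC w) ≡ just b
  compile-halts [] h {suc (suc y)} (s≤s (s≤s le)) = simulate-halts blank-rep h {y} le
  compile-halts {t} (b ∷ w) h {suc (suc y)} (s≤s (s≤s le)) =
    simulate-halts (input-rep (b ∷ w)) h {y} (≤-trans (*-monoʳ-≤ t (+-monoˡ-≤ 3 (*-monoʳ-≤ 2
      (+-monoˡ-≤ t (s≤s (≤-trans (≤-reflexive (List.length-map inSym w)) (n≤1+n _))))))) le)

-- Fuelled stack machines

module Fuel {k m : ℕ} {St St′ : Set} (P : St → Instr k m St) (D : St′ → Instr (suc k) m St′)
  (tick tock : St → St′) (dead : St′) where

  lift : Instr k m St → Instr (suc k) m St′
  lift (push i s q) = push (suc i) s (tick q)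
  lift (pop i f)    = pop (suc i) (tick ∘ f)
  lift (stop b)     = stop b

  exec-lift : ∀ i {X μ q μ′} → exec i μ ≡ just (q , μ′) → exec (lift i) (X ∷ μ) ≡ just (tick q , X ∷ μ′)
  exec-lift (push i s q) refl = refl
  exec-lift (pop i f)    refl = refl

  module _ (D-tick : ∀ u → D (tick u) ≡ pop zero (maybe′ (const (tock u)) dead))
    (D-tock : ∀ u → D (tock u) ≡ lift (P u)) (D-dead : D dead ≡ stop false) where

    start-tock : ∀ {u x X μ} → exec (D (tick u)) ((x ∷ X) ∷ μ) ≡ just (tock u , X ∷ μ)
    start-tock {u} rewrite D-tick u = refl

    -- Each simulated instruction first consumes a unit of fuel, whatever `P` does; this termination
    -- is what turns the diagonal machine into a decision procedure.
    fuel-halts : ∀ X u μ → Σ Bool (λ b → Halts D (2 + length X * 2) (tick u , X ∷ μ) b)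
    fuel-halts [] u μ = false , step (dies u) (stop D-dead)
      where
      dies : ∀ u → exec (D (tick u)) ([] ∷ μ) ≡ just (dead , [] ∷ μ)
      dies u rewrite D-tick u = refl
    fuel-halts (x ∷ X) u μ with P u in eq
    ... | stop b = b , step start-tock (stop (trans (D-tock u) (cong lift eq)))
    ... | push i s q with fuel-halts X q (μ [ i ]≔ (s ∷ lookup μ i))
    ...   | b , h = b , step start-tock (step (cong (λ j → exec j (X ∷ μ)) (trans (D-tock u) (cong lift eq))) h)
    fuel-halts (x ∷ X) u μ | pop i f
      with fuel-halts X (f (List.head (lookup μ i))) (μ [ i ]≔ drop 1 (lookup μ i))
    ...   | b , h = b , step start-tock (step (cong (λ j → exec j (X ∷ μ)) (trans (D-tock u) (cong lift eq))) h)

    -- The inequality is strict because the stopping instruction also consumes a unit of fuel.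
    fuel-sim : ∀ {t u μ b} → Halts P t (u , μ) b → ∀ X → t < length X →
      Halts D (2 + t * 2) (tick u , X ∷ μ) b
    fuel-sim (stop e) (x ∷ X) _ = step start-tock (stop (trans (D-tock _) (cong lift e)))
    fuel-sim {u = u} (step e h) (x ∷ X) (s≤s t<X) =
      step start-tock (step (trans (cong (λ j → exec j (X ∷ _)) (D-tock u)) (exec-lift (P u) e))
        (fuel-sim h X t<X))

-- The stacks of the universal machine hold: 0 the tape left of the head,
-- 1 the code already scanned, 2 an index into the table (in unary), 4 the code
-- still to be scanned, 5 the tape right of the head; 3 is unused.

module Universal (h : ℕ) where

  Sym : Set
  Sym = Fin (2 + h)

  pattern one′ = suc zero
  pattern 10F = suc 9F
  pattern 11F = suc 10F
  pattern 12F = suc 11F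
  pattern 13F = suc 12F
  pattern 14F = suc 13F
  pattern 15F = suc 14F
  pattern 16F = suc 15F
  pattern 17F = suc 16F
  pattern 18F = suc 17F
  pattern 19F = suc 18F
  pattern 20F = suc 19F
  pattern 21F = suc 20F
  pattern 22F = suc 21F

  data USt : Set where
    accept reject loadL loadL₁ loadR loadR₁ look : USt
    skip read goto goto₂ write write₂ sep rewind : Fin 5 → USt
    skip₁ read₁ goto₁ write₁ rewind₁ : Fin 5 → Sym → USt

  finite-USt : Finite USt
  finite-USt = finite-retract (finite-× (finite-Fin 20) (finite-× (finite-Fin 5) (finite-Fin (2 + h))))
    to from from-to
    where
    to : USt → Fin 20 × (Fin 5 × Sym)
    to accept = 0F , 0F , zero
    to reject = 1F , 0F , zero
    to loadL = 2F , 0F , zero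
    to loadL₁ = 3F , 0F , zero
    to loadR = 4F , 0F , zero
    to loadR₁ = 5F , 0F , zero
    to look = 6F , 0F , zero
    to (skip j) = 7F , j , zero
    to (read j) = 8F , j , zero
    to (goto j) = 9F , j , zero
    to (goto₂ j) = 10F , j , zero
    to (write j) = 11F , j , zero
    to (write₂ j) = 12F , j , zero
    to (sep j) = 13F , j , zero
    to (rewind j) = 14F , j , zero
    to (skip₁ j s) = 15F , j , s
    to (read₁ j s) = 16F , j , s
    to (goto₁ j s) = 17F , j , s
    to (write₁ j s) = 18F , j , s
    to (rewind₁ j s) = 19F , j , s
    from : Fin 20 × (Fin 5 × Sym) → USt
    from (0F , _) = accept
    from (1F , _) = reject
    from (2F , _) = loadL
    from (3F , _) = loadL₁
    from (4F , _) = loadR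
    from (5F , _) = loadR₁
    from (6F , _) = look
    from (7F , j , _) = skip j
    from (8F , j , _) = read j
    from (9F , j , _) = goto j
    from (10F , j , _) = goto₂ j
    from (11F , j , _) = write j
    from (12F , j , _) = write₂ j
    from (13F , j , _) = sep j
    from (14F , j , _) = rewind j
    from (15F , j , s) = skip₁ j s
    from (16F , j , s) = read₁ j s
    from (17F , j , s) = goto₁ j s
    from (18F , j , s) = write₁ j s
    from (19F , j , s) = rewind₁ j s
    from-to : ∀ u → from (to u) ≡ u
    from-to accept = refl
    from-to reject = refl
    from-to loadL = refl
    from-to loadL₁ = refl
    from-to loadR = refl
    from-to loadR₁ = refl
    from-to look = refl
    from-to (skip j) = refl
    from-to (read j) = refl
    from-to (goto j) = refl
    from-to (goto₂ j) = refl
    from-to (write j) = refl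
    from-to (write₂ j) = refl
    from-to (sep j) = refl
    from-to (rewind j) = refl
    from-to (skip₁ j s) = refl
    from-to (read₁ j s) = refl
    from-to (goto₁ j s) = refl
    from-to (write₁ j s) = refl
    from-to (rewind₁ j s) = refl

  -- Numbers are unary and closed by `zero`; any other symbol is a digit, as the alphabet is shared
  -- with the labels of worms. An exhausted stack ends a number too and thus reads as 0, the number
  -- of the blank.
  onMark : USt → USt → Maybe Sym → USt
  onMark a b nothing        = a
  onMark a b (just zero)    = a
  onMark a b (just (suc _)) = b

  skipped : Fin 5 → Sym → USt
  skipped j       (suc _) = skip j
  skipped zero    zero    = look
  skipped (suc j) zero    = skip (inject₁ j)

  -- A table entry starts with 0 or 1 for halting and with 2, 3, 4 for moving
  -- left, right, or not at all; 0F, 1F, 2F are these directions.  The answer of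
  -- the simulated machine is negated.
  actionRead : Fin 5 → USt
  actionRead 0F = accept
  actionRead 1F = reject
  actionRead 2F = goto 0F
  actionRead 3F = goto 1F
  actionRead 4F = goto 2F

  next : Fin 5 → Fin 5
  next 4F = 4F
  next 0F = 1F
  next 1F = 2F
  next 2F = 3F
  next 3F = 4F

  afterGoto : Fin 5 → USt
  afterGoto 0F = sep 0F
  afterGoto 1F = sep 1F
  afterGoto (suc (suc d)) = write (suc (suc d))

  afterRewind : Fin 5 → USt
  afterRewind 0F = loadL
  afterRewind 1F = loadR
  afterRewind (suc (suc _)) = look

  -- Each unit of the index makes `look` skip one entry, that is three fields. The symbol written
  -- goes to the side that the head leaves, or into the index if the head stays; after `rewind`, the
  -- symbol moved onto is added to the index.
  universal : USt → Instr 6 (2 + h) USt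
  universal accept        = stop true
  universal reject        = stop false
  universal loadL         = pop 0F (onMark look loadL₁)
  universal loadL₁        = push 2F zero loadL
  universal loadR         = pop 5F (onMark look loadR₁)
  universal loadR₁        = push 2F zero loadR
  universal look          = pop 2F (maybe′ (const (skip 2F)) (read 0F))
  universal (skip j)      = pop 4F (maybe′ (skip₁ j) look)
  universal (skip₁ j s)   = push 1F s (skipped j s)
  universal (read j)      = pop 4F (maybe′ (read₁ j) reject)
  universal (read₁ j s)   = push 1F s (onMark (actionRead j) (read (next j)) (just s))
  universal (goto d)      = pop 4F (maybe′ (goto₁ d) reject)
  universal (goto₁ d s)   = push 1F s (onMark (afterGoto d) (goto₂ d) (just s))
  universal (goto₂ d)     = push 2F zero (goto d)
  universal (sep 0F)      = push 5F zero (write 0F)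
  universal (sep (suc d)) = push 0F zero (write (suc d))
  universal (write d)     = pop 4F (maybe′ (write₁ d) reject)
  universal (write₁ d s)  = push 1F s (onMark (rewind d) (write₂ d) (just s))
  universal (write₂ 0F)   = push 5F one′ (write 0F)
  universal (write₂ 1F)   = push 0F one′ (write 1F)
  universal (write₂ (suc (suc d))) = push 2F zero (write (suc (suc d)))
  universal (rewind d)    = pop 1F (maybe′ (rewind₁ d) (afterRewind d))
  universal (rewind₁ d s) = push 4F s (rewind d)

  una : ℕ → List Sym → List Sym
  una zero    r = zero ∷ r
  una (suc n) r = one′ ∷ una n r

  marks : ℕ → List Sym → List Sym
  marks zero    r = r
  marks (suc n) r = marks n (zero ∷ r)

  ones : ℕ → List Sym → List Sym
  ones zero    r = r
  ones (suc n) r = ones n (one′ ∷ r)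

  -- the scanned code after a field n has been moved onto it
  scanned : ℕ → List Sym → List Sym
  scanned zero    d = zero ∷ d
  scanned (suc n) d = scanned n (one′ ∷ d)

  scanned-ʳ++ : ∀ n d c → scanned n d ʳ++ c ≡ d ʳ++ una n c
  scanned-ʳ++ zero    d c = refl
  scanned-ʳ++ (suc n) d c = scanned-ʳ++ n (one′ ∷ d) c

  length-scanned : ∀ n d → length (scanned n d) ≡ suc (n + length d)
  length-scanned zero    d = refl
  length-scanned (suc n) d = trans (length-scanned n (one′ ∷ d)) (cong suc (+-suc n (length d)))

  length-marks : ∀ n r → length (marks n r) ≡ n + length r
  length-marks zero    r = refl
  length-marks (suc n) r = trans (length-marks n (zero ∷ r)) (+-suc n (length r))

  ones-una : ∀ n j r → ones n (una j r) ≡ una (n + j) r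
  ones-una zero    j r = refl
  ones-una (suc n) j r = trans (ones-una n (suc j) r) (cong (λ z → una z r) (+-suc n j))

  mem : (l d n y c r : List Sym) → Mem 6 (2 + h)
  mem l d n y c r = l ∷ d ∷ n ∷ y ∷ c ∷ r ∷ []

  UReach : ℕ → USt × Mem 6 (2 + h) → USt × Mem 6 (2 + h) → Set
  UReach = Reach universal

  loadR-run : ∀ k {l d n y c r} →
    UReach (1 + k * 2) (loadR , mem l d n y c (una k r)) (look , mem l d (marks k n) y c r)
  loadR-run zero    = step refl done
  loadR-run (suc k) = step refl (step refl (loadR-run k))

  loadL-run : ∀ k {l d n y c r} →
    UReach (1 + k * 2) (loadL , mem (una k l) d n y c r) (look , mem l d (marks k n) y c r)
  loadL-run zero    = step refl done
  loadL-run (suc k) = step refl (step refl (loadL-run k))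

  skip-field : ∀ j k {l d n y c r} →
    UReach (2 + k * 2) (skip j , mem l d n y (una k c) r) (skipped j zero , mem l (scanned k d) n y c r)
  skip-field j zero    = step refl (step refl done)
  skip-field j (suc k) = step refl (step refl (skip-field j k))

  goto-field : ∀ t k {l d n y c r} →
    UReach (2 + k * 3) (goto t , mem l d n y (una k c) r) (afterGoto t , mem l (scanned k d) (marks k n) y c r)
  goto-field t zero    = step refl (step refl done)
  goto-field t (suc k) = step refl (step refl (step refl (goto-field t k)))

  write-field-L : ∀ k {l d n y c r} →
    UReach (2 + k * 3) (write 0F , mem l d n y (una k c) r) (rewind 0F , mem l (scanned k d) n y c (ones k r))
  write-field-L zero    = step refl (step refl done)
  write-field-L (suc k) = step refl (step refl (step refl (write-field-L k)))

  write-field-R : ∀ k {l d n y c r} →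
    UReach (2 + k * 3) (write 1F , mem l d n y (una k c) r) (rewind 1F , mem (ones k l) (scanned k d) n y c r)
  write-field-R zero    = step refl (step refl done)
  write-field-R (suc k) = step refl (step refl (step refl (write-field-R k)))

  write-field-S : ∀ k {l d n y c r} →
    UReach (2 + k * 3) (write 2F , mem l d n y (una k c) r) (rewind 2F , mem l (scanned k d) (marks k n) y c r)
  write-field-S zero    = step refl (step refl done)
  write-field-S (suc k) = step refl (step refl (step refl (write-field-S k)))

  rewind-run : ∀ t d {l n y c r} →
    UReach (1 + length d * 2) (rewind t , mem l d n y c r) (afterRewind t , mem l [] n y (d ʳ++ c) r)
  rewind-run t []      = step refl done
  rewind-run t (s ∷ d) = step refl (step refl (rewind-run t d))

  Entry : Set
  Entry = ℕ × ℕ × ℕ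

  entryCode : Entry → List Sym → List Sym
  entryCode (a , b , c) r = una a (una b (una c r))

  tableCode : List Entry → List Sym → List Sym
  tableCode []       r = r
  tableCode (e ∷ es) r = entryCode e (tableCode es r)

  tableCode-++ : ∀ es es′ r → tableCode (es ++ es′) r ≡ tableCode es (tableCode es′ r)
  tableCode-++ []       es′ r = refl
  tableCode-++ (e ∷ es) es′ r = cong (entryCode e) (tableCode-++ es es′ r)

  scannedEntry : Entry → List Sym → List Sym
  scannedEntry (a , b , c) d = scanned c (scanned b (scanned a d))

  scannedTable : List Entry → List Sym → List Sym
  scannedTable []       d = d
  scannedTable (e ∷ es) d = scannedTable es (scannedEntry e d)

  -- The time to skip an entry, including the pop of one unit of the index.
  weight : Entry → ℕ
  weight (a , b , c) = 1 + ((2 + a * 2) + ((2 + b * 2) + (2 + c * 2)))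

  weights : List Entry → ℕ
  weights []       = 0
  weights (e ∷ es) = weight e + weights es

  weights-++ : ∀ es es′ → weights (es ++ es′) ≡ weights es + weights es′
  weights-++ []       es′ = refl
  weights-++ (e ∷ es) es′ = trans (cong (weight e +_) (weights-++ es es′)) (sym (+-assoc (weight e) _ _))

  scannedEntry-ʳ++ : ∀ e d c → scannedEntry e d ʳ++ c ≡ d ʳ++ entryCode e c
  scannedEntry-ʳ++ (x , y , z) d c = trans (scanned-ʳ++ z _ c)
    (trans (scanned-ʳ++ y _ _) (scanned-ʳ++ x d _))

  scannedTable-ʳ++ : ∀ es d c → scannedTable es d ʳ++ c ≡ d ʳ++ tableCode es c
  scannedTable-ʳ++ []       d c = refl
  scannedTable-ʳ++ (e ∷ es) d c = trans (scannedTable-ʳ++ es _ c) (scannedEntry-ʳ++ e d _)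

  length-scannedEntry : ∀ e d → length (scannedEntry e d) ≤ weight e + length d
  length-scannedEntry (x , y , z) d
    rewrite length-scanned z (scanned y (scanned x d)) | length-scanned y (scanned x d) | length-scanned x d =
    ≤-trans (m≤m+n _ (4 + (x + y + z))) (≤-reflexive (identity x y z (length d)))
    where
    identity : ∀ x y z l → suc (z + suc (y + suc (x + l))) + (4 + (x + y + z)) ≡
      1 + ((2 + x * 2) + ((2 + y * 2) + (2 + z * 2))) + l
    identity = solve-∀

  length-scannedTable : ∀ es d → length (scannedTable es d) ≤ weights es + length d
  length-scannedTable []       d = ≤-refl
  length-scannedTable (e ∷ es) d = ≤-trans (length-scannedTable es (scannedEntry e d))
    (≤-trans (+-monoʳ-≤ (weights es) (length-scannedEntry e d))
      (≤-reflexive (identity (weights es) (weight e) (length d))))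
    where
    identity : ∀ a b c → a + (b + c) ≡ b + a + c
    identity = solve-∀

  skip-entries : ∀ es n {l d y c r} → length n ≡ length es →
    UReach (weights es + 1) (look , mem l d n y (tableCode es c) r) (read 0F , mem l (scannedTable es d) [] y c r)
  skip-entries []                   []      _  = step refl done
  skip-entries ((a , b , c) ∷ es) (_ ∷ n) eq =
    reach-weaken universal (s≤s (≤-reflexive (sym (assoc (2 + a * 2) (2 + b * 2) (2 + c * 2) (weights es)))))
      (step refl (_⟫_ universal (skip-field 2F a) (_⟫_ universal (skip-field 1F b)
        (_⟫_ universal (skip-field 0F c) (skip-entries es n (suc-injective eq))))))
    where
    assoc : ∀ x y z w → x + (y + z) + w + 1 ≡ x + (y + (z + (w + 1)))
    assoc = solve-∀

  module _ (M : TM) where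
    open TM M renaming (Q to Qᴹ; G to Gᴹ)

    K : ℕ
    K = 3 + Gᴹ

    moveNumber : Move → ℕ
    moveNumber mL = 2
    moveNumber mR = 3
    moveNumber mS = 4

    -- The target state is stored as K · q, the position of its first entry; adding the scanned
    -- symbol then only requires pushing marks.
    entry : Action Qᴹ Gᴹ → Entry
    entry (halt false) = 0 , 0 , 0
    entry (halt true)  = 1 , 0 , 0
    entry (go q s m)   = moveNumber m , K * toℕ q , toℕ s

    entryAt : Fin (suc Qᴹ * K) → Entry
    entryAt i = entry (uncurry δ (remQuot K i))

    table : List Entry
    table = List.tabulate entryAt

    -- Searching, executing and rewinding are charged to the table's weight, and loading a symbol to
    -- K. The cost depends on `M` only, so the simulation is a linear slowdown.
    stepCost : ℕ
    stepCost = 6 + (4 * weights table + 2 * K)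

    tape : List (Fin K) → List Sym
    tape []       = []
    tape (s ∷ ss) = una (toℕ s) (tape ss)

    tabulate-split : ∀ {n} (f : Fin n → Entry) i →
      Σ (List Entry) (λ pre → Σ (List Entry) (λ post →
        (List.tabulate f ≡ pre ++ f i ∷ post) × (length pre ≡ toℕ i)))
    tabulate-split f zero    = [] , List.tabulate (f ∘ suc) , refl , refl
    tabulate-split f (suc i) with tabulate-split (f ∘ suc) i
    ... | pre , post , eq , len = f zero ∷ pre , post , cong (f zero ∷_) eq , cong suc len

    -- the state and the scanned symbol are stored as an index into the table
    Indexes : List Sym → Fin (suc Qᴹ) → Fin K → Set
    Indexes n q s = length n ≡ K * toℕ q + toℕ s

    module _ (y rest : List Sym) where

      code : List Sym
      code = tableCode table rest

      memAt : List Sym → Config Qᴹ Gᴹ → Mem 6 (2 + h)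
      memAt n c = mem (tape (Config.left c)) [] n y code (tape (Config.right c))

      -- Beyond the stored tape the next symbol is the blank, whose number 0 is exactly what an
      -- exhausted stack contributes to the index.
      loadR-tape : ∀ q ls s rs n → length n ≡ K * toℕ q →
        Σ (List Sym) (λ n′ → Indexes n′ (Config.state {Qᴹ} {Gᴹ} (moveC mR q ls s rs)) (Config.cur {Qᴹ} {Gᴹ} (moveC mR q ls s rs)) ×
          UReach (1 + K * 2) (loadR , mem (una (toℕ s) (tape ls)) [] n y code (tape rs))
            (look , memAt n′ (moveC mR q ls s rs)))
      loadR-tape q ls s [] n len = n , trans len (sym (+-identityʳ _)) , step refl done
      loadR-tape q ls s (r ∷ rs) n len = marks (toℕ r) n ,
        trans (length-marks (toℕ r) n) (trans (cong (toℕ r +_) len) (+-comm (toℕ r) _)) ,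
        reach-weaken universal (s≤s (*-monoˡ-≤ 2 (<⇒≤ (Fin.toℕ<n r)))) (loadR-run (toℕ r))

      loadL-tape : ∀ q ls s rs n → length n ≡ K * toℕ q →
        Σ (List Sym) (λ n′ → Indexes n′ (Config.state {Qᴹ} {Gᴹ} (moveC mL q ls s rs)) (Config.cur {Qᴹ} {Gᴹ} (moveC mL q ls s rs)) ×
          UReach (1 + K * 2) (loadL , mem (tape ls) [] n y code (una (toℕ s) (tape rs)))
            (look , memAt n′ (moveC mL q ls s rs)))
      loadL-tape q [] s rs n len = n , trans len (sym (+-identityʳ _)) , step refl done
      loadL-tape q (l ∷ ls) s rs n len = marks (toℕ l) n ,
        trans (length-marks (toℕ l) n) (trans (cong (toℕ l +_) len) (+-comm (toℕ l) _)) ,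
        reach-weaken universal (s≤s (*-monoˡ-≤ 2 (<⇒≤ (Fin.toℕ<n l)))) (loadL-run (toℕ l))

      ones-tape : ∀ k (s : Fin K) r → k ≡ toℕ s → ones k (zero ∷ r) ≡ una (toℕ s) r
      ones-tape k s r refl = trans (ones-una k 0 r) (cong (λ z → una z r) (+-identityʳ k))

      finish : ∀ t {l d n c r} → d ʳ++ c ≡ code → length d ≤ weights table →
        UReach (1 + weights table * 2) (rewind t , mem l d n y c r) (afterRewind t , mem l [] n y code r)
      finish t {l} {d} {n} {c} {r} eq short =
        subst (λ z → UReach (1 + weights table * 2) (rewind t , mem l d n y c r) (afterRewind t , mem l [] n y z r)) eq
          (reach-weaken universal (s≤s (*-monoˡ-≤ 2 short)) (rewind-run t d))

      execCost : ℕ → ℕ → ℕ → ℕ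
      execCost m b c = weight (m , b , c) * 2 + (2 + (weights table * 2 + (1 + K * 2)))

      execCost-bound : ∀ m b c → (2 + m * 2) + ((2 + b * 3) + (1 + ((2 + c * 3) +
        ((1 + weights table * 2) + (1 + K * 2))))) ≤ execCost m b c
      execCost-bound m b c = ≤-trans (m≤m+n _ (8 + m * 2 + b + c))
        (≤-reflexive (identity m b c (weights table) K))
        where
        identity : ∀ m b c w k → (2 + m * 2) + ((2 + b * 3) + (1 + ((2 + c * 3) +
          ((1 + w * 2) + (1 + k * 2))))) + (8 + m * 2 + b + c) ≡
          (1 + ((2 + m * 2) + ((2 + b * 2) + (2 + c * 2)))) * 2 + (2 + (w * 2 + (1 + k * 2)))
        identity = solve-∀

      module _ (q : Fin (suc Qᴹ)) (s : Fin K) (ls rs : List (Fin K)) (d c : List Sym) where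

        b₀ c₀ : ℕ
        b₀ = K * toℕ q
        c₀ = toℕ s

        index₀ : length (marks b₀ []) ≡ K * toℕ q
        index₀ = trans (length-marks b₀ []) (+-identityʳ b₀)

        execute : ∀ m → d ʳ++ entryCode (entry (go q s m)) c ≡ code →
          weight (entry (go q s m)) + length d ≤ weights table →
          Σ (List Sym) (λ n′ →
            Indexes n′ (Config.state (moveC m q ls s rs)) (Config.cur (moveC m q ls s rs)) ×
            UReach (execCost (moveNumber m) b₀ c₀)
              (read 0F , mem (tape ls) d [] y (entryCode (entry (go q s m)) c) (tape rs))
              (look , memAt n′ (moveC m q ls s rs)))
        execute mL eq short with loadL-tape q ls s rs (marks b₀ []) index₀
        ... | n′ , ix , r = n′ , ix , reach-weaken universal (execCost-bound 2 b₀ c₀)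
          (_⟫_ universal read₂ (_⟫_ universal (goto-field 0F b₀) (step refl (_⟫_ universal (write-field-L c₀)
            (_⟫_ universal (finish 0F (trans (scannedEntry-ʳ++ (2 , b₀ , c₀) d c) eq)
                (≤-trans (length-scannedEntry (2 , b₀ , c₀) d) short))
              (subst (λ z → UReach (1 + K * 2) (loadL , mem (tape ls) [] (marks b₀ []) y code z)
                (look , memAt n′ (moveC mL q ls s rs))) (sym (ones-tape c₀ s (tape rs) refl)) r))))))
          where
          read₂ : UReach 6 (read 0F , mem (tape ls) d [] y (una 2 (una b₀ (una c₀ c))) (tape rs))
            (goto 0F , mem (tape ls) (scanned 2 d) [] y (una b₀ (una c₀ c)) (tape rs))
          read₂ = step refl (step refl (step refl (step refl (step refl (step refl done)))))
        execute mR eq short with loadR-tape q ls s rs (marks b₀ []) index₀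
        ... | n′ , ix , r = n′ , ix , reach-weaken universal (execCost-bound 3 b₀ c₀)
          (_⟫_ universal read₃ (_⟫_ universal (goto-field 1F b₀) (step refl (_⟫_ universal (write-field-R c₀)
            (_⟫_ universal (finish 1F (trans (scannedEntry-ʳ++ (3 , b₀ , c₀) d c) eq)
                (≤-trans (length-scannedEntry (3 , b₀ , c₀) d) short))
              (subst (λ z → UReach (1 + K * 2) (loadR , mem z [] (marks b₀ []) y code (tape rs))
                (look , memAt n′ (moveC mR q ls s rs))) (sym (ones-tape c₀ s (tape ls) refl)) r))))))
          where
          read₃ : UReach 8 (read 0F , mem (tape ls) d [] y (una 3 (una b₀ (una c₀ c))) (tape rs))
            (goto 1F , mem (tape ls) (scanned 3 d) [] y (una b₀ (una c₀ c)) (tape rs))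
          read₃ = step refl (step refl (step refl (step refl (step refl (step refl (step refl (step refl done)))))))
        execute mS eq short = marks c₀ (marks b₀ []) ,
          trans (length-marks c₀ _) (trans (cong (c₀ +_) index₀) (+-comm c₀ _)) ,
          reach-weaken universal (≤-trans bound (execCost-bound 4 b₀ c₀))
            (_⟫_ universal read₄ (_⟫_ universal (goto-field 2F b₀) (_⟫_ universal (write-field-S c₀)
              (finish 2F (trans (scannedEntry-ʳ++ (4 , b₀ , c₀) d c) eq)
                (≤-trans (length-scannedEntry (4 , b₀ , c₀) d) short)))))
          where
          read₄ : UReach 10 (read 0F , mem (tape ls) d [] y (una 4 (una b₀ (una c₀ c))) (tape rs))
            (goto 2F , mem (tape ls) (scanned 4 d) [] y (una b₀ (una c₀ c)) (tape rs))
          read₄ = step refl (step refl (step refl (step refl (step refl (step refl (step refl (step refl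
            (step refl (step refl done)))))))))
          bound : 10 + ((2 + b₀ * 3) + ((2 + c₀ * 3) + (1 + weights table * 2))) ≤
            10 + ((2 + b₀ * 3) + (1 + ((2 + c₀ * 3) + ((1 + weights table * 2) + (1 + K * 2)))))
          bound = +-monoʳ-≤ 10 (+-monoʳ-≤ (2 + b₀ * 3) (≤-trans (+-monoʳ-≤ (2 + c₀ * 3) (m≤m+n _ _)) (n≤1+n _)))

      record Located (p : Fin (suc Qᴹ)) (s : Fin K) (a : Action Qᴹ Gᴹ) : Set where
        field
          before after : List Entry
          code-split   : code ≡ tableCode before (entryCode (entry a) (tableCode after rest))
          position     : length before ≡ K * toℕ p + toℕ s
          light        : weights before + weight (entry a) ≤ weights table

      locate : ∀ p s → Located p s (δ p s)
      locate p s with tabulate-split entryAt (combine p s)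
      ... | pre , post , eq , len = record
        { before = pre ; after = post
        ; code-split = trans (cong (λ t → tableCode t rest) table≡) (tableCode-++ pre _ rest)
        ; position = trans len (Fin.toℕ-combine p s)
        ; light = ≤-trans (+-monoʳ-≤ (weights pre) (m≤m+n (weight (entry (δ p s))) (weights post)))
            (≤-reflexive (sym (trans (cong weights table≡) (weights-++ pre (entry (δ p s) ∷ post)))))
        }
        where
        table≡ : table ≡ pre ++ entry (δ p s) ∷ post
        table≡ = trans eq (cong (λ x → pre ++ entry (uncurry δ x) ∷ post) (Fin.remQuot-combine p s))

      find : ∀ {p s a} (loc : Located p s a) {l n r} → Indexes n p s →
        UReach (weights (Located.before loc) + 1) (look , mem l [] n y code r)
          (read 0F , mem l (scannedTable (Located.before loc) []) [] y
            (entryCode (entry a) (tableCode (Located.after loc) rest)) r)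
      find {a = a} loc {l} {n} {r} ix =
        subst (λ z → UReach (weights before + 1) (look , mem l [] n y z r)
            (read 0F , mem l (scannedTable before []) [] y (entryCode (entry a) (tableCode after rest)) r))
          (sym code-split) (skip-entries before n (trans ix (sym position)))
        where open Located loc

      simStep : ∀ {q s m p cur} ls rs n → Located p cur (go q s m) → Indexes n p cur →
        Σ (List Sym) (λ n′ →
          Indexes n′ (Config.state (moveC m q ls s rs)) (Config.cur (moveC m q ls s rs)) ×
          UReach stepCost (look , memAt n (cfg p ls cur rs)) (look , memAt n′ (moveC m q ls s rs)))
      simStep {q} {s} {m} {p} {cur} ls rs n loc ix with execute q s ls rs
          (scannedTable (Located.before loc) []) (tableCode (Located.after loc) rest) m
          (trans (scannedTable-ʳ++ (Located.before loc) [] _) (sym (Located.code-split loc)))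
          (≤-trans (+-monoʳ-≤ (weight (entry (go q s m))) (length-scannedTable (Located.before loc) []))
            (≤-trans (≤-reflexive (trans (cong (weight (entry (go q s m)) +_) (+-identityʳ _))
              (+-comm _ (weights (Located.before loc))))) (Located.light loc)))
      ... | n′ , ix′ , r = n′ , ix′ , reach-weaken universal bound (_⟫_ universal (find loc ix) r)
        where
        open Located loc
        open ≤-Reasoning
        e : Entry
        e = entry (go q s m)
        regroup : ∀ a b w k → a + 1 + (b * 2 + (2 + (w * 2 + (1 + k * 2)))) + (a + 2) ≡ (a + b) * 2 + (6 + (2 * w + 2 * k))
        regroup = solve-∀
        split : ∀ w k → w * 2 + (6 + (2 * w + 2 * k)) ≡ 6 + (4 * w + 2 * k)
        split = solve-∀
        bound : weights before + 1 + execCost (moveNumber m) (K * toℕ q) (toℕ s) ≤ stepCost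
        bound = begin
          weights before + 1 + (weight e * 2 + (2 + (weights table * 2 + (1 + K * 2))))
            ≤⟨ m≤m+n _ (weights before + 2) ⟩
          weights before + 1 + (weight e * 2 + (2 + (weights table * 2 + (1 + K * 2)))) + (weights before + 2)
            ≡⟨ regroup (weights before) (weight e) (weights table) K ⟩
          (weights before + weight e) * 2 + (6 + (2 * weights table + 2 * K))
            ≤⟨ +-monoˡ-≤ _ (*-monoˡ-≤ 2 light) ⟩
          weights table * 2 + (6 + (2 * weights table + 2 * K)) ≡⟨ split (weights table) K ⟩
          stepCost ∎

      weights≤stepCost : ∀ {w} → w ≤ weights table → w + 1 + 4 ≤ stepCost
      weights≤stepCost {w} le = begin
        w + 1 + 4                       ≡⟨ +-assoc w 1 4 ⟩
        w + 5                           ≤⟨ +-monoˡ-≤ 5 le ⟩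
        weights table + 5               ≤⟨ m≤m+n _ (1 + (3 * weights table + 2 * K)) ⟩
        weights table + 5 + (1 + (3 * weights table + 2 * K)) ≡⟨ identity (weights table) K ⟩
        stepCost ∎
        where
        open ≤-Reasoning
        identity : ∀ w k → w + 5 + (1 + (3 * w + 2 * k)) ≡ 6 + (4 * w + 2 * k)
        identity = solve-∀

      simHalt : ∀ {p cur} ls rs n b → Located p cur (halt b) → Indexes n p cur →
        Halts universal stepCost (look , memAt n (cfg p ls cur rs)) (not b)
      simHalt ls rs n false loc ix = halts-weaken universal
        (weights≤stepCost (≤-trans (m≤m+n _ _) (Located.light loc)))
        (_⟫ₕ_ universal {t = 4} (find loc ix) (step refl (step refl (stop refl))))
      simHalt ls rs n true loc ix = halts-weaken universal
        (weights≤stepCost (≤-trans (m≤m+n _ _) (Located.light loc)))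
        (_⟫ₕ_ universal {t = 4} (find loc ix) (step refl (step refl (step refl (step refl (stop refl))))))

      sim : ∀ t c n b → runAct M t c ≡ just b → Indexes n (Config.state c) (Config.cur c) →
        Halts universal (suc t * stepCost) (look , memAt n c) (not b)
      simAct : ∀ t p ls cur rs n b a → Located p cur a → runWith M t (cfg p ls cur rs) a ≡ just b →
        Indexes n p cur → Halts universal (suc t * stepCost) (look , memAt n (cfg p ls cur rs)) (not b)
      sim t (cfg p ls cur rs) n b r ix = simAct t p ls cur rs n b (δ p cur) (locate p cur) r ix
      simAct t p ls cur rs n b (halt b′) loc r ix with refl ← just-injective r =
        halts-weaken universal (m≤m+n stepCost (t * stepCost)) (simHalt ls rs n b′ loc ix)
      simAct (suc t) p ls cur rs n b (go q s m) loc r ix =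
        _⟫ₕ_ universal {stepCost} {suc t * stepCost} (proj₂ (proj₂ (simStep ls rs n loc ix)))
          (sim t (moveC m q ls s rs) _ b r (proj₁ (proj₂ (simStep ls rs n loc ix))))

      -- The start state contributes 0 to the index, so starting in `loadR` fetches the first letter
      -- as if after a move to the right. Its number is at most 2, which 6 steps cover.
      sim-init : ∀ t w b → runAct M t (initC w) ≡ just b →
        Halts universal (6 + suc t * stepCost) (loadR , mem [] [] [] y code (tape (map inSym w))) (not b)
      sim-init t [] b r = halts-weaken universal (m≤n+m _ 5)
        (step refl (sim t (initC []) [] b r (sym (trans (+-identityʳ _) (*-zeroʳ K)))))
      sim-init t (a ∷ w) b r = halts-weaken universal (+-monoˡ-≤ (suc t * stepCost) (bound a))
        (_⟫ₕ_ universal (loadR-run (toℕ (inSym {Gᴹ} a)))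
          (sim t (initC (a ∷ w)) (marks (toℕ (inSym {Gᴹ} a)) []) b r
            (trans (length-marks (toℕ (inSym {Gᴹ} a)) []) (trans (+-identityʳ _)
              (cong (_+ toℕ (inSym {Gᴹ} a)) (sym (*-zeroʳ K)))))))
        where
        bound : ∀ a → 1 + toℕ (inSym {Gᴹ} a) * 2 ≤ 6
        bound false = s≤s (s≤s (s≤s z≤n))
        bound true  = s≤s (s≤s (s≤s (s≤s (s≤s z≤n))))

-- The diagonal machine

times : {A : Set} → ℕ → List A → List A → List A
times zero    blk r = r
times (suc n) blk r = times n blk (blk ++ r)

times-comm : ∀ {A : Set} n (blk r : List A) → times n blk (blk ++ r) ≡ blk ++ times n blk r
times-comm zero    blk r = refl
times-comm (suc n) blk r = times-comm n blk (blk ++ r)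

module Diagonal (h : ℕ) (W : List (Fin (2 + h))) where

  open Universal h

  data DSt : Set where
    charge₁ charge₂ load load₅ worm grow copy back count count₁ refill refill₁ clear dead : DSt
    load₁ load₂ load₃ load₄ cut copy₁ copy₂ back₁ : Sym → DSt
    cut₁ : Sym → Sym → DSt
    init : Fin (length W) → DSt
    tick tock : USt → DSt

  finite-DSt : Finite DSt
  finite-DSt = finite-retract
    (finite-⊎ (finite-× (finite-Fin 23) (finite-× (finite-Fin (2 + h)) (finite-Fin (2 + h))))
      (finite-⊎ (finite-Fin (length W)) (finite-⊎ finite-USt finite-USt)))
    to from from-to
    where
    Code : Set
    Code = (Fin 23 × (Sym × Sym)) ⊎ (Fin (length W) ⊎ (USt ⊎ USt))
    to : DSt → Code
    to charge₁ = inj₁ (0F , zero , zero)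
    to charge₂ = inj₁ (1F , zero , zero)
    to load = inj₁ (2F , zero , zero)
    to load₅ = inj₁ (3F , zero , zero)
    to worm = inj₁ (4F , zero , zero)
    to grow = inj₁ (5F , zero , zero)
    to copy = inj₁ (6F , zero , zero)
    to back = inj₁ (7F , zero , zero)
    to count = inj₁ (8F , zero , zero)
    to count₁ = inj₁ (9F , zero , zero)
    to refill = inj₁ (10F , zero , zero)
    to refill₁ = inj₁ (11F , zero , zero)
    to clear = inj₁ (12F , zero , zero)
    to dead = inj₁ (13F , zero , zero)
    to (load₁ s) = inj₁ (14F , s , zero)
    to (load₂ s) = inj₁ (15F , s , zero)
    to (load₃ s) = inj₁ (16F , s , zero)
    to (load₄ s) = inj₁ (17F , s , zero)
    to (cut s) = inj₁ (18F , s , zero)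
    to (copy₁ s) = inj₁ (19F , s , zero)
    to (copy₂ s) = inj₁ (20F , s , zero)
    to (back₁ s) = inj₁ (21F , s , zero)
    to (cut₁ t s) = inj₁ (22F , t , s)
    to (init i) = inj₂ (inj₁ i)
    to (tick u) = inj₂ (inj₂ (inj₁ u))
    to (tock u) = inj₂ (inj₂ (inj₂ u))
    from : Code → DSt
    from (inj₁ (0F , _)) = charge₁
    from (inj₁ (1F , _)) = charge₂
    from (inj₁ (2F , _)) = load
    from (inj₁ (3F , _)) = load₅
    from (inj₁ (4F , _)) = worm
    from (inj₁ (5F , _)) = grow
    from (inj₁ (6F , _)) = copy
    from (inj₁ (7F , _)) = back
    from (inj₁ (8F , _)) = count
    from (inj₁ (9F , _)) = count₁
    from (inj₁ (10F , _)) = refill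
    from (inj₁ (11F , _)) = refill₁
    from (inj₁ (12F , _)) = clear
    from (inj₁ (13F , _)) = dead
    from (inj₁ (14F , s , _)) = load₁ s
    from (inj₁ (15F , s , _)) = load₂ s
    from (inj₁ (16F , s , _)) = load₃ s
    from (inj₁ (17F , s , _)) = load₄ s
    from (inj₁ (18F , s , _)) = cut s
    from (inj₁ (19F , s , _)) = copy₁ s
    from (inj₁ (20F , s , _)) = copy₂ s
    from (inj₁ (21F , s , _)) = back₁ s
    from (inj₁ (22F , t , s)) = cut₁ t s
    from (inj₂ (inj₁ i)) = init i
    from (inj₂ (inj₂ (inj₁ u))) = tick u
    from (inj₂ (inj₂ (inj₂ u))) = tock u
    from-to : ∀ q → from (to q) ≡ q
    from-to charge₁ = refl
    from-to charge₂ = refl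
    from-to load = refl
    from-to load₅ = refl
    from-to worm = refl
    from-to grow = refl
    from-to copy = refl
    from-to back = refl
    from-to count = refl
    from-to count₁ = refl
    from-to refill = refl
    from-to refill₁ = refl
    from-to clear = refl
    from-to dead = refl
    from-to (load₁ s) = refl
    from-to (load₂ s) = refl
    from-to (load₃ s) = refl
    from-to (load₄ s) = refl
    from-to (cut s) = refl
    from-to (copy₁ s) = refl
    from-to (copy₂ s) = refl
    from-to (back₁ s) = refl
    from-to (cut₁ t s) = refl
    from-to (init i) = refl
    from-to (tick u) = refl
    from-to (tock u) = refl

  -- Pushing a fixed list takes one state for each of its positions.
  nextInit : (xs : List Sym) → (Fin (length xs) → DSt) → DSt
  nextInit []       e = worm
  nextInit (x ∷ xs) e = e zero

  initInstr : (xs : List Sym) → (Fin (length xs) → DSt) → Fin (length xs) → Instr 7 (2 + h) DSt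
  initInstr (x ∷ xs) e zero    = push 1F x (nextInit xs (e ∘ suc))
  initInstr (x ∷ xs) e (suc i) = initInstr xs (e ∘ suc) i

  onZero : DSt → DSt → Sym → DSt
  onZero a b zero    = a
  onZero a b (suc _) = b

  onEqual : DSt → DSt → Bool → DSt
  onEqual a b true  = a
  onEqual a b false = b

  wormTop : Sym → DSt
  wormTop zero    = grow
  wormTop (suc d) = cut (inject₁ d)

  fuelled : Instr 6 (2 + h) USt → Instr 7 (2 + h) DSt
  fuelled (push i s q) = push (suc i) s (tick q)
  fuelled (pop i f)    = pop (suc i) (tick ∘ f)
  fuelled (stop b)     = stop b

  -- The stacks hold: 0 the counter and later the fuel, 1 the input, then the
  -- worm, then the simulated tape left of the head, 2 the segment being copied,
  -- 5 the input as a table, 6 the simulated tape right of the head.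
  -- A worm is rewritten thus: remove its top label; if it was 0, increment the
  -- counter x, and if it was i + 1, cut the top segment down to the first
  -- label i and put x + 1 copies of it back.
  diagonal : DSt → Instr 7 (2 + h) DSt
  diagonal charge₁    = push 0F zero charge₂
  diagonal charge₂    = push 0F zero load
  diagonal load       = pop 1F (maybe′ load₁ (nextInit W init))
  diagonal (load₁ s)  = push 5F s (load₂ s)
  diagonal (load₂ s)  = push 0F zero (load₃ s)
  diagonal (load₃ s)  = push 6F zero (load₄ s)
  diagonal (load₄ s)  = push 6F one′ (onZero load load₅ s)
  diagonal load₅      = push 6F one′ load
  diagonal (init i)   = initInstr W init i
  diagonal worm       = pop 1F (maybe′ wormTop (tick loadR))
  diagonal grow       = push 0F zero worm
  diagonal (cut t)    = pop 1F (maybe′ (cut₁ t) worm)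
  diagonal (cut₁ t s) = push 2F s (onEqual copy (cut t) (does (s Fin.≟ t)))
  diagonal copy       = pop 2F (maybe′ copy₁ back)
  diagonal (copy₁ s)  = push 1F s (copy₂ s)
  diagonal (copy₂ s)  = push 3F s copy
  diagonal back       = pop 3F (maybe′ back₁ count)
  diagonal (back₁ s)  = push 2F s back
  diagonal count      = pop 0F (maybe′ (const count₁) refill)
  diagonal count₁     = push 4F zero copy
  diagonal refill     = pop 4F (maybe′ (const refill₁) clear)
  diagonal refill₁    = push 0F zero refill
  diagonal clear      = pop 2F (maybe′ (const clear) worm)
  diagonal (tick u)   = pop 0F (maybe′ (const (tock u)) dead)
  diagonal (tock u)   = fuelled (universal u)
  diagonal dead       = stop false

  open Fuel universal diagonal tick tock dead

  fuelled-lift : ∀ i → fuelled i ≡ lift i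
  fuelled-lift (push _ _ _) = refl
  fuelled-lift (pop _ _)    = refl
  fuelled-lift (stop _)     = refl

  dmem : (x s u v y c r : List Sym) → Mem 7 (2 + h)
  dmem x s u v y c r = x ∷ s ∷ u ∷ v ∷ y ∷ c ∷ r ∷ []

  DReach : ℕ → DSt × Mem 7 (2 + h) → DSt × Mem 7 (2 + h) → Set
  DReach = Reach diagonal

  infixr 5 _>>>_
  _>>>_ : ∀ {s t c c′ c″} → DReach s c c′ → DReach t c′ c″ → DReach (s + t) c c″
  _>>>_ = _⟫_ diagonal

  ticks : ℕ → List Sym
  ticks n = replicate n zero

  cut-run : ∀ {t} seg → All (_≢ t) seg → ∀ {x r u v y c e} →
    DReach (length seg * 2 + 2) (cut t , dmem x (seg ++ t ∷ r) u v y c e)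
      (copy , dmem x r (t ∷ (seg ʳ++ u)) v y c e)
  cut-run {t} [] [] {x} {r} {u} {v} {y} {c} {e} =
    step refl (step (cong (λ b → just (onEqual copy (cut t) b , dmem x r (t ∷ u) v y c e)) (dec-true (t Fin.≟ t) refl)) done)
  cut-run {t} (s ∷ seg) (s≢t ∷ ps) {x} {r} {u} {v} {y} {c} {e} =
    step refl (step (cong (λ b → just (onEqual copy (cut t) b , dmem x (seg ++ t ∷ r) (s ∷ u) v y c e))
      (dec-false (s Fin.≟ t) s≢t)) (cut-run seg ps))

  copy-run : ∀ u {x s v y c e} →
    DReach (1 + length u * 3) (copy , dmem x s u v y c e) (back , dmem x (u ʳ++ s) [] (u ʳ++ v) y c e)
  copy-run []      = step refl done
  copy-run (a ∷ u) = step refl (step refl (step refl (copy-run u)))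

  back-run : ∀ v {x s u y c e} →
    DReach (1 + length v * 2) (back , dmem x s u v y c e) (count , dmem x s (v ʳ++ u) [] y c e)
  back-run []      = step refl done
  back-run (a ∷ v) = step refl (step refl (back-run v))

  block-run : ∀ u {x s y c e} →
    DReach (2 + length u * 5) (copy , dmem x s u [] y c e) (count , dmem x (u ʳ++ s) u [] y c e)
  block-run u {x} {s} {y} {c} {e} = reach-weaken diagonal (≤-reflexive cost)
    (copy-run u >>> subst (λ z → DReach (1 + length (u ʳ++ []) * 2) (back , dmem x (u ʳ++ s) [] (u ʳ++ []) y c e)
      (count , dmem x (u ʳ++ s) z [] y c e)) twice (back-run (u ʳ++ [])))
    where
    twice : (u ʳ++ []) ʳ++ [] ≡ u
    twice = trans (List.ʳ++-ʳ++ u) (List.++-identityʳ u)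
    identity : ∀ l → 1 + l * 3 + (1 + l * 2) ≡ 2 + l * 5
    identity = solve-∀
    cost : 1 + length u * 3 + (1 + length (u ʳ++ []) * 2) ≡ 2 + length u * 5
    cost = trans (cong (λ l → 1 + length u * 3 + (1 + l * 2)) (List.length-reverse u)) (identity (length u))

  count-run : ∀ n j u {s c e} →
    DReach (1 + n * (4 + length u * 5)) (count , dmem (ticks n) s u [] (ticks j) c e)
      (refill , dmem [] (times n (reverse u) s) u [] (ticks (n + j)) c e)
  count-run zero    j u = step refl done
  count-run (suc n) j u {s} {c} {e} = reach-weaken diagonal (≤-reflexive (identity n (length u)))
    (step refl (step refl (block-run u >>>
      subst₂ (λ z k → DReach (1 + n * (4 + length u * 5)) (count , dmem (ticks n) z u [] (ticks (suc j)) c e)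
          (refill , dmem [] (times n (reverse u) (reverse u ++ s)) u [] (ticks k) c e))
        (sym (List.ʳ++-defn u)) (+-suc n j) (count-run n (suc j) u))))
    where
    identity : ∀ n l → 2 + (2 + l * 5 + (1 + n * (4 + l * 5))) ≡ 1 + suc n * (4 + l * 5)
    identity = solve-∀

  refill-run : ∀ n j {s u v c e} →
    DReach (1 + n * 2) (refill , dmem (ticks j) s u v (ticks n) c e) (clear , dmem (ticks (n + j)) s u v [] c e)
  refill-run zero    j = step refl done
  refill-run (suc n) j {s} {u} {v} {c} {e} = step refl (step refl
    (subst (λ k → DReach (1 + n * 2) (refill , dmem (ticks (suc j)) s u v (ticks n) c e) (clear , dmem (ticks k) s u v [] c e))
      (+-suc n j) (refill-run n (suc j))))

  clear-run : ∀ u {x s v y c e} →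
    DReach (1 + length u) (clear , dmem x s u v y c e) (worm , dmem x s [] v y c e)
  clear-run []      = step refl done
  clear-run (_ ∷ u) = step refl (clear-run u)

  state : ℕ → List Sym → List Sym → List Sym → Mem 7 (2 + h)
  state x s c e = dmem (ticks x) s [] [] [] c e

  -- One copy is made before the counter is first consulted and one more for each of its units,
  -- hence `suc x`. All passes together cost at most 15 steps per label of the copies.
  cut-worm : ∀ {d t} seg → inject₁ d ≡ t → All (_≢ t) seg → ∀ x r {c e} →
    DReach (15 * (suc x * suc (length seg))) (worm , state x (suc d ∷ seg ++ t ∷ r) c e)
      (worm , state x (times (suc x) (seg ∷ʳ t) r) c e)
  cut-worm {d} {t} seg refl ps x r {c} {e} = reach-weaken diagonal bound
    (step refl (cut-run seg ps >>> block-run u >>>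
      subst₂ (λ z b → DReach (1 + x * (4 + length u * 5)) (count , dmem (ticks x) z u [] [] c e)
          (refill , dmem [] (times x b (blk ++ r)) u [] (ticks (x + 0)) c e))
        u-r reverse-u (count-run x 0 u) >>>
      subst (λ k → DReach (1 + (x + 0) * 2) (refill , dmem [] (times x blk (blk ++ r)) u [] (ticks (x + 0)) c e)
          (clear , dmem (ticks k) (times x blk (blk ++ r)) u [] [] c e))
        (trans (+-identityʳ (x + 0)) (+-identityʳ x)) (refill-run (x + 0) 0) >>>
      clear-run u))
    where
    blk u : List Sym
    blk = seg ∷ʳ t
    u = t ∷ (seg ʳ++ [])
    reverse-u : reverse u ≡ blk
    reverse-u = trans (List.unfold-reverse t (seg ʳ++ [])) (cong (_∷ʳ t) (List.reverse-involutive seg))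
    u-r : blk ++ r ≡ u ʳ++ r
    u-r = sym (trans (List.ʳ++-defn u) (cong (_++ r) reverse-u))
    length-u : length u ≡ suc (length seg)
    length-u = cong suc (List.length-reverse seg)
    identity : ∀ l x → suc (l * 2 + 2 + (2 + suc l * 5 + (1 + x * (4 + suc l * 5) + (1 + (x + 0) * 2 + (1 + suc l)))))
      + (l * 7 + 1 + x * (4 + l * 10)) ≡ 15 * (suc x * suc l)
    identity = solve-∀
    bound : suc (length seg * 2 + 2 + (2 + length u * 5 + (1 + x * (4 + length u * 5) + (1 + (x + 0) * 2 + (1 + length u)))))
      ≤ 15 * (suc x * suc (length seg))
    bound = subst (λ z → suc (length seg * 2 + 2 + (2 + z * 5 + (1 + x * (4 + z * 5) + (1 + (x + 0) * 2 + (1 + z)))))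
        ≤ 15 * (suc x * suc (length seg))) (sym length-u)
      (≤-trans (m≤m+n _ (length seg * 7 + 1 + x * (4 + length seg * 10))) (≤-reflexive (identity (length seg) x)))

-- Worms: terms as lists of the depths of their nodes

-- Clamped at `n` to be total; `Fits` ensures that the labels are the true depths.
lev : ∀ {n} → ℕ → Fin (suc n)
lev         zero    = zero
lev {zero}  (suc i) = zero
lev {suc n} (suc i) = suc (lev i)

toℕ-lev : ∀ {n i} → i ≤ n → toℕ (lev {n} i) ≡ i
toℕ-lev             z≤n       = refl
toℕ-lev {suc n} (s≤s i≤n) = cong suc (toℕ-lev i≤n)

inject₁-lev : ∀ {n i} → i ≤ n → inject₁ (lev {n} i) ≡ lev {suc n} i
inject₁-lev             z≤n       = refl
inject₁-lev {suc n} (s≤s i≤n) = cong suc (inject₁-lev i≤n)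

nodes : Ord → ℕ
nodes 𝟎          = 0
nodes (ω^ a + b) = suc (nodes a + nodes b)

length-times : ∀ {A : Set} n (blk r : List A) → length (times n blk r) ≡ n * length blk + length r
length-times zero    blk r = refl
length-times (suc n) blk r = trans (length-times n blk (blk ++ r))
  (trans (cong (n * length blk +_) (List.length-++ blk)) (identity (n * length blk) (length blk) (length r)))
  where
  identity : ∀ a b c → a + (b + c) ≡ b + a + c
  identity = solve-∀

module Worm (h : ℕ) where

  Label : Set
  Label = Fin (2 + h)

  -- the nodes of a term in preorder, the last one first
  enc : ℕ → Ord → List Label → List Label
  enc j 𝟎          r = r
  enc j (ω^ a + b) r = enc j b (enc (suc j) a (lev j ∷ r))

  Fits : ℕ → Ord → Set
  Fits j 𝟎          = ⊤
  Fits j (ω^ a + b) = (j ≤ suc h) × (Fits (suc j) a × Fits j b)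

  fits : ∀ j a → j + nodes a ≤ 2 + h → Fits j a
  fits j 𝟎          le = tt
  fits j (ω^ a + b) le =
    ≤-pred (≤-trans (≤-trans (s≤s (m≤m+n j _)) (≤-reflexive (sym (+-suc j _)))) le) ,
    fits (suc j) a (≤-trans (s≤s (+-monoʳ-≤ j (m≤m+n (nodes a) (nodes b)))) (≤-trans (≤-reflexive (sym (+-suc j _))) le)) ,
    fits j b (≤-trans (+-monoʳ-≤ j (≤-trans (m≤n+m (nodes b) (nodes a)) (n≤1+n _))) le)

  enc-++ : ∀ j a r s → enc j a (r ++ s) ≡ enc j a r ++ s
  enc-++ j 𝟎          r s = refl
  enc-++ j (ω^ a + b) r s = trans (cong (enc j b) (enc-++ (suc j) a (lev j ∷ r) s)) (enc-++ j b _ s)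

  enc-block : ∀ j a t r → enc j a (t ∷ r) ≡ (enc j a [] ∷ʳ t) ++ r
  enc-block j a t r = trans (enc-++ j a [] (t ∷ r)) (sym (List.++-assoc (enc j a []) (t ∷ []) r))

  length-enc : ∀ j a r → length (enc j a r) ≡ nodes a + length r
  length-enc j 𝟎          r = refl
  length-enc j (ω^ a + b) r = trans (length-enc j b _)
    (trans (cong (nodes b +_) (length-enc (suc j) a (lev j ∷ r))) (identity (nodes a) (nodes b) (length r)))
    where
    identity : ∀ a b r → b + (a + suc r) ≡ suc (a + b + r)
    identity = solve-∀

  -- In preorder, a subtree is its root followed by deeper labels. Hence the first label i met below
  -- a removed i + 1 is the parent, and the cut segment is the rest of the parent's subtree.
  enc-deep : ∀ {i} j a r → i ≤ j → Fits j a → All (λ s → i ≤ toℕ s) r → All (λ s → i ≤ toℕ s) (enc j a r)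
  enc-deep j 𝟎          r i≤j _              ps = ps
  enc-deep j (ω^ a + b) r i≤j (j≤ , fa , fb) ps =
    enc-deep j b _ i≤j fb (enc-deep (suc j) a _ (m≤n⇒m≤1+n i≤j) fa
      (≤-trans i≤j (≤-reflexive (sym (toℕ-lev j≤))) ∷ ps))

  enc-succ : ∀ a {b} j r → kind a ≡ succ b → enc j a r ≡ lev j ∷ enc j b r
  enc-succ (ω^ 𝟎 + 𝟎) j r refl = refl
  enc-succ (ω^ a + (ω^ c + d)) j r k with kind (ω^ c + d) in k′ | trans (sym (kind-tail a c d)) k
  ... | succ _ | refl = enc-succ (ω^ c + d) j (enc (suc j) a (lev j ∷ r)) k′

  fits-succ : ∀ a {b} j → kind a ≡ succ b → Fits j a → Fits j b × (j ≤ suc h)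
  fits-succ (ω^ 𝟎 + 𝟎) j refl (p , _) = tt , p
  fits-succ (ω^ a + (ω^ c + d)) j k (p , fa , fb) with kind (ω^ c + d) in k′ | trans (sym (kind-tail a c d)) k
  ... | succ _ | refl = (p , fa , proj₁ (fits-succ (ω^ c + d) j k′ fb)) , p

  fits-times : ∀ j {a} n → j ≤ suc h → Fits (suc j) a → Fits j (ωtimes a n)
  fits-times j zero    p fa = p , fa , tt
  fits-times j (suc n) p fa = p , fa , fits-times j n p fa

  fits-fund : ∀ j a x → Fits j a → Fits j (fund a x)
  fits-fund j 𝟎                    x f              = tt
  fits-fund j (ω^ a + (ω^ c + d)) x (p , fa , fb)  = p , fa , fits-fund j (ω^ c + d) x fb
  fits-fund j (ω^ a + 𝟎)           x (p , fa , _) with kind a in k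
  ... | zer     = tt
  ... | succ a′ = fits-times j x p (proj₁ (fits-succ a (suc j) k fa))
  ... | lim     = p , fits-fund (suc j) a x fa , tt

  kind-tail-lim⁻ : ∀ a c d → kind (ω^ a + (ω^ c + d)) ≡ lim → kind (ω^ c + d) ≡ lim
  kind-tail-lim⁻ a c d k with kind (ω^ c + d) | trans (sym (kind-tail a c d)) k
  ... | lim | _ = refl

  nodes-succ : ∀ a {b} → kind a ≡ succ b → nodes a ≡ suc (nodes b)
  nodes-succ a {b} k = trans (trans (sym (+-identityʳ (nodes a))) (sym (length-enc 0 a [])))
    (trans (cong length (enc-succ a 0 [] k)) (cong suc (trans (length-enc 0 b []) (+-identityʳ (nodes b)))))

  module _ (W : List Label) where

    open Diagonal h W

    enc-times : ∀ i a n r → enc i (ωtimes a n) r ≡ times (suc n) (enc (suc i) a [] ∷ʳ lev i) r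
    enc-times i a zero    r = enc-block (suc i) a (lev i) r
    enc-times i a (suc n) r = trans (enc-times i a n _)
      (cong (times (suc n) (enc (suc i) a [] ∷ʳ lev i)) (enc-block (suc i) a (lev i) r))

    -- One move at a limit: the last leaf `suc δ`, its parent `τ`, and between them the rest of the
    -- parent's subtree. The field `copies` identifies the move with `fund`.
    record Cuttable (j : ℕ) (a : Ord) (r : List Label) : Set where
      field
        δ       : Fin (suc h)
        τ       : Label
        seg r′  : List Label
        shape   : enc j a r ≡ suc δ ∷ seg ++ τ ∷ r′
        target  : inject₁ δ ≡ τ
        avoids  : All (_≢ τ) seg
        copies  : ∀ x → enc j (fund a x) r ≡ times (suc x) (seg ∷ʳ τ) r′

    cut-succ : ∀ a {b} i r → i ≤ h → Fits (suc i) b → kind a ≡ succ b →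
      Σ (Fin (suc h)) (λ d → (enc (suc i) a (lev i ∷ r) ≡ suc d ∷ enc (suc i) b [] ++ lev i ∷ r) ×
        (inject₁ d ≡ lev i) × All (_≢ lev i) (enc (suc i) b []))
    cut-succ a {b} i r i≤h fb k = lev i ,
      trans (enc-succ a (suc i) (lev i ∷ r) k) (cong (lev (suc i) ∷_) (enc-++ (suc i) b [] (lev i ∷ r))) ,
      inject₁-lev i≤h ,
      mapAll (λ i<s s≡ → <-irrefl (trans (sym (toℕ-lev (m≤n⇒m≤1+n i≤h))) (cong toℕ (sym s≡))) i<s)
        (enc-deep (suc i) b [] ≤-refl fb [])

    cuttable : ∀ j a r → kind a ≡ lim → Fits j a → Cuttable j a r
    cuttable-pow : ∀ j a r {ka} → kind a ≡ ka → kind (ω^ a + 𝟎) ≡ lim → Fits (suc j) a → Cuttable j (ω^ a + 𝟎) r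

    cuttable j (ω^ a + (ω^ c + d)) r k (p , fa , fb) =
      record { Cuttable (cuttable j (ω^ c + d) (enc (suc j) a (lev j ∷ r)) (kind-tail-lim⁻ a c d k) fb) }
    cuttable j (ω^ a + 𝟎) r k (p , fa , _) = cuttable-pow j a r refl k fa

    cuttable-pow j 𝟎          r {zer} ka () fa
    cuttable-pow j (ω^ a + b) r {zer} ka k fa with () ← kind-pow-≢zer a b ka
    cuttable-pow j a r {succ a′} ka k fa with fits-succ a (suc j) ka fa
    ... | fa′ , s≤s j≤h with cut-succ a j r j≤h fa′ ka
    ...   | d , sh , tg , av = record
      { δ = d ; τ = lev j ; seg = enc (suc j) a′ [] ; r′ = r ; shape = sh ; target = tg ; avoids = av
      ; copies = λ x → trans (cong (λ z → enc j z r) (fund-pow-succ a ka x)) (enc-times j a′ x r) }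
    cuttable-pow j a r {lim} ka k fa = record
      { Cuttable rec ; copies = λ x → trans (cong (λ z → enc j z r) (fund-pow-lim a ka x)) (Cuttable.copies rec x) }
      where
      rec : Cuttable (suc j) a (lev j ∷ r)
      rec = cuttable (suc j) a (lev j ∷ r) ka fa

    -- A leaf disappears and x additional copies of the remaining subtree appear; this is read off
    -- from the lengths of the encodings before and after the cut.
    nodes-fund : ∀ {j a r} (c : Cuttable j a r) x →
      suc (nodes (fund a x)) ≡ nodes a + x * suc (length (Cuttable.seg c))
    nodes-fund {j} {a} {r} c x = +-cancelʳ-≡ (length r + suc (length seg) + length r′) _ _ (begin
      suc f + (R + s + R′)       ≡⟨ identity₁ f R s R′ ⟩
      (f + R) + (suc s + R′)     ≡⟨ cong₂ _+_ eq₁ (sym eq₂) ⟩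
      (suc x * s + R′) + (sa + R) ≡⟨ identity₂ x s R′ sa R ⟩
      sa + x * s + (R + s + R′)  ∎)
      where
      open Cuttable c
      open ≡-Reasoning
      f s R R′ sa : ℕ
      f = nodes (fund a x)
      s = suc (length seg)
      R = length r
      R′ = length r′
      sa = nodes a
      length-blk : length (seg ∷ʳ τ) ≡ s
      length-blk = trans (List.length-++ seg) (+-comm (length seg) 1)
      eq₁ : f + R ≡ suc x * s + R′
      eq₁ = trans (sym (length-enc j (fund a x) r)) (trans (cong length (copies x))
        (trans (length-times (suc x) (seg ∷ʳ τ) r′) (cong (λ l → suc x * l + R′) length-blk)))
      eq₂ : sa + R ≡ suc s + R′
      eq₂ = trans (sym (length-enc j a r)) (trans (cong length shape)
        (cong suc (trans (List.length-++ seg) (+-suc (length seg) R′))))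
      identity₁ : ∀ f R s R′ → suc f + (R + s + R′) ≡ (f + R) + (suc s + R′)
      identity₁ = solve-∀
      identity₂ : ∀ x s R′ sa R → (suc x * s + R′) + (sa + R) ≡ sa + x * s + (R + s + R′)
      identity₂ = solve-∀

    -- The running time is charged to the growth of the counter: an exponent
    -- with s nodes still to be processed carries a credit of 45 (s + 2), which
    -- grows enough in each cut to pay for the copying because x ≥ 2.

    credit : ℕ → ℕ
    credit s = 45 * (s + 2)

    -- Each unit of the counter is worth 92 steps: two for the increment itself and 90 for the
    -- credit of the exponent 𝟎 that it uses up.
    Clocked : List Label → ℕ → ℕ → List Label → ℕ → Set
    Clocked s x y r k = Σ ℕ (λ t → (∀ {c e} → DReach t (worm , state x s c e) (worm , state y r c e)) ×
      (t + k + 92 * x ≤ 92 * y))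

    succ-credit : ∀ {x s} → 2 ≤ x → 15 * (suc x * suc s) + credit (suc s) ≤ suc x * credit s
    succ-credit {s = s} (s≤s (s≤s {n = w} _)) = ≤-by _ (identity w s)
      where
      identity : ∀ w s → (3 + w) * (45 * (s + 2)) ≡
        15 * ((3 + w) * suc s) + 45 * (suc s + 2) + (45 * s + 30 * (w * s) + 75 * w + 90)
      identity = solve-∀

    -- Equality holds for x = 2 and s = 0, which explains 45 = 3 · 15. For x = 1 and s = 0 the
    -- number of nodes would not grow and nothing could pay for the cut; this is why the counter
    -- starts at n + 2.
    lim-credit : ∀ {x s a f} → 2 ≤ x → suc f ≡ a + x * suc s → 15 * (suc x * suc s) + credit a ≤ credit f
    lim-credit {s = s} {a} {f} (s≤s (s≤s {n = w} _)) eq = +-cancelʳ-≤ 45 _ _ (begin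
      15 * ((3 + w) * suc s) + 45 * (a + 2) + 45                       ≤⟨ m≤m+n _ (30 * w + 45 * s + 30 * (w * s)) ⟩
      15 * ((3 + w) * suc s) + 45 * (a + 2) + 45 + (30 * w + 45 * s + 30 * (w * s)) ≡⟨ identity w s a ⟩
      45 * (a + (2 + w) * suc s + 2)                                   ≡⟨ cong (λ z → 45 * (z + 2)) eq ⟨
      45 * (suc f + 2)                                                 ≡⟨ identity′ f ⟩
      45 * (f + 2) + 45                                                ∎)
      where
      open ≤-Reasoning
      identity : ∀ w s a → 15 * ((3 + w) * suc s) + 45 * (a + 2) + 45 + (30 * w + 45 * s + 30 * (w * s)) ≡
        45 * (a + (2 + w) * suc s + 2)
      identity = solve-∀
      identity′ : ∀ f → 45 * (suc f + 2) ≡ 45 * (f + 2) + 45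
      identity′ = solve-∀

    pay : ∀ c t k k′ u v → c + k′ ≤ k → t + k + u ≤ v → (c + t) + k′ + u ≤ v
    pay c t k k′ u v p q = ≤-trans (≤-reflexive (identity c t k′ u)) (≤-trans (+-monoˡ-≤ u (+-monoʳ-≤ t p)) q)
      where
      identity : ∀ c t k′ u → (c + t) + k′ + u ≡ t + (c + k′) + u
      identity = solve-∀

    -- The label 0 is the root of a summand ω^a, with the labels of `a` above it. For a = 𝟎 the move
    -- is the increment F_0; for a successor the cut reaches the root and leaves x + 1 summands ω^b,
    -- the iteration that defines F_(b+1); for a limit it stays inside `a`.
    clock-FG : ∀ {a x y} → FG a x y → 2 ≤ x → Fits 1 a → ∀ r →
      Clocked (enc 1 a (zero ∷ r)) x y r (credit (nodes a))
    clock-Iter : ∀ {a n x y} → Iter (FG a) n x y → 2 ≤ x → Fits 1 a → ∀ r →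
      Clocked (times n (enc 1 a [] ∷ʳ zero) r) x y r (n * credit (nodes a))

    clock-FG {x = x} fg0 2≤x f r = 2 , step refl (step refl done) , ≤-reflexive (identity x)
      where
      identity : ∀ x → 2 + 90 + 92 * x ≡ 92 * suc x
      identity = solve-∀
    clock-FG {a} {x} {y} (fgSuc {β = b} k it) 2≤x f r
      with clock-Iter it 2≤x (proj₁ (fits-succ a 1 k f)) r | cut-succ a 0 r z≤n (proj₁ (fits-succ a 1 k f)) k
    ... | t , run , le | d , sh , tg , av =
      15 * (suc x * suc (length seg)) + t ,
      (λ {c} {e} → subst (λ z → DReach _ (worm , state x z c e) (worm , state y r c e)) (sym sh)
        (cut-worm seg tg av x r >>> run)) ,
      pay (15 * (suc x * suc (length seg))) t (suc x * credit (nodes b)) (credit (nodes a)) (92 * x) (92 * y)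
        (subst₂ (λ l z → 15 * (suc x * suc l) + credit z ≤ suc x * credit (nodes b))
          (sym (trans (length-enc 1 b []) (+-identityʳ (nodes b)))) (sym (nodes-succ a k)) (succ-credit 2≤x)) le
      where
      seg : List Label
      seg = enc 1 b []
    clock-FG {a} {x} {y} (fgLim k d) 2≤x f r
      with clock-FG d 2≤x (fits-fund 1 a x f) r | cuttable 1 a (zero ∷ r) k f
    ... | t , run , le | cuts =
      15 * (suc x * suc (length seg)) + t ,
      (λ {c} {e} → subst (λ z → DReach _ (worm , state x z c e) (worm , state y r c e)) (sym shape)
        (cut-worm seg target avoids x r′ >>>
          subst (λ z → DReach t (worm , state x z c e) (worm , state y r c e)) (copies x) run)) ,
      pay (15 * (suc x * suc (length seg))) t (credit (nodes (fund a x))) (credit (nodes a)) (92 * x) (92 * y)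
        (lim-credit {a = nodes a} 2≤x (nodes-fund cuts x)) le
      where open Cuttable cuts

    clock-Iter it0 2≤x f r = 0 , done , ≤-refl
    clock-Iter {a} {suc n} {x} {y} (itS {y = y′} d it) 2≤x f r
      with clock-FG d 2≤x f (times n blk r) | clock-Iter it (≤-trans 2≤x (subst (x ≤_) (sym (F-value d)) (<⇒≤ (F-infl a x)))) f r
      where
      blk : List Label
      blk = enc 1 a [] ∷ʳ zero
    ... | t , run , le | t′ , run′ , le′ = t + t′ ,
      (λ {c} {e} → subst (λ z → DReach _ (worm , state x z c e) (worm , state y r c e))
        (trans (enc-block 1 a zero _) (sym (times-comm n (enc 1 a [] ∷ʳ zero) r))) (run >>> run′)) ,
      ≤-trans (≤-reflexive (identity t t′ (credit (nodes a)) (n * credit (nodes a)) (92 * x)))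
        (≤-trans (+-monoʳ-≤ (t′ + n * credit (nodes a)) le) le′)
      where
      identity : ∀ t t′ c n x → (t + t′) + (c + n) + x ≡ (t′ + n) + (t + c + x)
      identity = solve-∀

halts-unique : ∀ {k m St} (P : St → Instr k m St) {s t c b b′} → Halts P s c b → Halts P t c b′ → b ≡ b′
halts-unique P (stop e)    (stop e′)    with refl ← trans (sym e) e′ = refl
halts-unique P (stop e)    (step e′ h)  rewrite e with () ← e′
halts-unique P (step e h)  (stop e′)    rewrite e′ with () ← e
halts-unique P (step e h)  (step e′ h′) with refl ← trans (sym e) e′ = halts-unique P h h′

-- Machine tables as input words, and loading the input

unary : ℕ → List Bool → List Bool
unary zero    r = false ∷ r
unary (suc n) r = true ∷ unary n r

unary-length : ∀ n r → length r ≤ length (unary n r)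
unary-length zero    r = n≤1+n _
unary-length (suc n) r = m≤n⇒m≤1+n (unary-length n r)

tableWord : List (ℕ × ℕ × ℕ) → List Bool → List Bool
tableWord []                 r = r
tableWord ((a , b , c) ∷ es) r = unary a (unary b (unary c (tableWord es r)))

tableWord-length : ∀ es r → length r ≤ length (tableWord es r)
tableWord-length []                 r = ≤-refl
tableWord-length ((a , b , c) ∷ es) r = ≤-trans (tableWord-length es r)
  (≤-trans (unary-length c _) (≤-trans (unary-length b _) (unary-length a _)))

module Load (h : ℕ) (W : List (Fin (2 + h))) where

  open Universal h
  open Diagonal h W

  una-unary : ∀ n r → map bit (unary n r) ≡ una n (map bit r)
  una-unary zero    r = refl
  una-unary (suc n) r = cong (one′ ∷_) (una-unary n r)

  tableCode-word : ∀ es r → map bit (tableWord es r) ≡ tableCode es (map bit r)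
  tableCode-word []                 r = refl
  tableCode-word ((a , b , c) ∷ es) r =
    trans (una-unary a _) (cong (una a) (trans (una-unary b _) (cong (una b)
      (trans (una-unary c _) (cong (una c) (tableCode-word es r))))))

  -- The unary number of an input letter in the tape alphabet of `TM`: 1 for false, 2 for true.
  cellCode : Sym → List Sym → List Sym
  cellCode zero    e = one′ ∷ zero ∷ e
  cellCode (suc _) e = one′ ∷ one′ ∷ zero ∷ e

  loaded : List Sym → List Sym → List Sym
  loaded []       e = e
  loaded (s ∷ xs) e = loaded xs (cellCode s e)

  load-run : ∀ xs x {c e} →
    DReach (1 + length xs * 6) (load , dmem (ticks x) xs [] [] [] c e)
      (nextInit W init , dmem (ticks (length xs + x)) [] [] [] [] (xs ʳ++ c) (loaded xs e))
  load-run []       x = step refl done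
  load-run (s ∷ xs) x {c} {e} = letter s
    where
    after : ∀ s → DReach (1 + length xs * 6) (load , dmem (ticks (suc x)) xs [] [] [] (s ∷ c) (cellCode s e))
      (nextInit W init , dmem (ticks (suc (length xs + x))) [] [] [] [] (xs ʳ++ (s ∷ c)) (loaded xs (cellCode s e)))
    after s = subst (λ k → DReach (1 + length xs * 6) (load , dmem (ticks (suc x)) xs [] [] [] (s ∷ c) (cellCode s e))
      (nextInit W init , dmem (ticks k) [] [] [] [] (xs ʳ++ (s ∷ c)) (loaded xs (cellCode s e))))
      (+-suc (length xs) x) (load-run xs (suc x))
    letter : ∀ s → DReach (1 + (6 + length xs * 6)) (load , dmem (ticks x) (s ∷ xs) [] [] [] c e)
      (nextInit W init , dmem (ticks (suc (length xs + x))) [] [] [] [] (xs ʳ++ (s ∷ c)) (loaded xs (cellCode s e)))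
    letter zero    = reach-weaken diagonal (n≤1+n _)
      (step refl (step refl (step refl (step refl (step refl (after zero))))))
    letter (suc d) = step refl (step refl (step refl (step refl (step refl (step refl (after (suc d)))))))

  init-run : ∀ xs (e : Fin (length xs) → DSt) → (∀ i → diagonal (e i) ≡ initInstr xs e i) →
    ∀ {x s u v y c r} → DReach (length xs) (nextInit xs e , dmem x s u v y c r) (worm , dmem x (xs ʳ++ s) u v y c r)
  init-run []       e eq = done
  init-run (a ∷ xs) e eq {x} {s} {u} {v} {y} {c} {r} =
    step (cong (λ i → exec i (dmem x s u v y c r)) (eq zero)) (init-run xs (e ∘ suc) (eq ∘ suc))

  tapeOf : List Bool → List Sym
  tapeOf []      = []
  tapeOf (b ∷ w) = cellCode (bit b) (tapeOf w)

  loaded-reverse : ∀ w xs → loaded (map bit w ʳ++ xs) [] ≡ loaded xs (tapeOf w)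
  loaded-reverse []      xs = refl
  loaded-reverse (b ∷ w) xs = loaded-reverse w (bit b ∷ xs)

  tapeOf-tape : ∀ M w → tapeOf w ≡ tape M (map inSym w)
  tapeOf-tape M []          = refl
  tapeOf-tape M (false ∷ w) = cong (λ z → one′ ∷ zero ∷ z) (tapeOf-tape M w)
  tapeOf-tape M (true ∷ w)  = cong (λ z → one′ ∷ one′ ∷ zero ∷ z) (tapeOf-tape M w)

-- The witness language

module Witness (β : Ord) (2≤β : two ≤ₒ β) (c : ℕ) where

  -- The depth of a term is at most its number of nodes, so `nodes β` yields an alphabet large
  -- enough for all labels of the game.
  h : ℕ
  h = nodes β

  open Worm h

  block worm₀ W : List Label
  block = enc 1 β [] ∷ʳ zero
  worm₀ = times (suc c) block []
  W = worm₀ ʳ++ []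

  open Universal h
  open Diagonal h W
  open Load h W
  open Fuel universal diagonal tick tock dead

  module Machine = Compile {7} {h} 1F finite-DSt diagonal charge₁

  clock : ℕ → ℕ
  clock n = iter (F β) (suc c) (2 + n)

  n≤clock : ∀ n → 2 + n ≤ clock n
  n≤clock n = iter-infl (F-infl β) (suc c) (2 + n)

  W-worm₀ : W ʳ++ [] ≡ worm₀
  W-worm₀ = trans (List.ʳ++-ʳ++ worm₀) (List.++-identityʳ worm₀)

  prepare : ∀ w → DReach (length W + 92 * clock (length w)) (charge₁ , Machine.σ₀ w)
    (tick loadR , dmem (ticks (clock (length w))) [] [] [] [] (map bit w) (tapeOf w))
  prepare w with clock-Iter W {a = β} {n = suc c} (iter-Iter (F-graph β) (suc c) (2 + length w))
    (s≤s (s≤s z≤n)) (fits 1 β (n≤1+n _)) []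
  ... | t , run , le = reach-weaken diagonal cost
    (step refl (step refl (loading >>> initialising >>> (run >>> step refl done))))
    where
    n : ℕ
    n = length w
    xs : List Sym
    xs = reverse (map bit w)
    length-xs : length xs ≡ n
    length-xs = trans (List.length-reverse (map bit w)) (List.length-map bit w)
    loading : DReach (1 + n * 6) (load , dmem (ticks 2) xs [] [] [] [] [])
      (nextInit W init , state (2 + n) [] (map bit w) (tapeOf w))
    loading = subst₂ (λ l z → DReach (1 + l * 6) (load , dmem (ticks 2) xs [] [] [] [] [])
        (nextInit W init , state z [] (map bit w) (tapeOf w))) length-xs (trans (+-comm _ 2) (cong (2 +_) length-xs))
      (subst₂ (λ z e → DReach (1 + length xs * 6) (load , dmem (ticks 2) xs [] [] [] [] [])
          (nextInit W init , state (length xs + 2) [] z e))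
        (trans (List.ʳ++-ʳ++ (map bit w)) (List.++-identityʳ (map bit w))) (loaded-reverse w [])
        (load-run xs 2))
    initialising : DReach (length W) (nextInit W init , state (2 + n) [] (map bit w) (tapeOf w))
      (worm , state (2 + n) worm₀ (map bit w) (tapeOf w))
    initialising = subst (λ z → DReach (length W) (nextInit W init , state (2 + n) [] (map bit w) (tapeOf w))
        (worm , state (2 + n) z (map bit w) (tapeOf w))) W-worm₀
      (init-run W init (λ _ → refl))
    -- Loading takes 6 steps per letter; they are charged to the 92 · (2 + n) that belongs to the
    -- initial value of the counter.
    cost : 2 + (1 + n * 6 + (length W + (t + 1))) ≤ length W + 92 * clock n
    cost = begin
      2 + (1 + n * 6 + (length W + (t + 1)))          ≤⟨ m≤m+n _ (180 + 86 * n) ⟩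
      2 + (1 + n * 6 + (length W + (t + 1))) + (180 + 86 * n) ≡⟨ identity n (length W) t ⟩
      length W + (t + 92 * (2 + n))                   ≤⟨ +-monoʳ-≤ (length W) (+-monoˡ-≤ (92 * (2 + n)) (m≤m+n t _)) ⟩
      length W + (t + suc c * credit W (nodes β) + 92 * (2 + n)) ≤⟨ +-monoʳ-≤ (length W) le ⟩
      length W + 92 * clock n                         ∎
      where
      open ≤-Reasoning
      identity : ∀ n l t → 2 + (1 + n * 6 + (l + (t + 1))) + (180 + 86 * n) ≡ l + (t + 92 * (2 + n))
      identity = solve-∀

  length-ticks : ∀ n → length (ticks n) ≡ n
  length-ticks n = List.length-replicate n

  verdict : ∀ w → Σ Bool (Halts diagonal ((length W + 92 * clock (length w)) + (2 + clock (length w) * 2))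
    (charge₁ , Machine.σ₀ w))
  verdict w with fuel-halts (λ _ → refl) (λ u → fuelled-lift (universal u)) refl
    (ticks (clock (length w))) loadR (mem [] [] [] [] (map bit w) (tapeOf w))
  ... | b , halts = b , _⟫ₕ_ diagonal (prepare w)
    (subst (λ k → Halts diagonal (2 + k * 2)
      (tick loadR , dmem (ticks (clock (length w))) [] [] [] [] (map bit w) (tapeOf w)) b) (length-ticks (clock (length w))) halts)

  language : Language
  language w = proj₁ (verdict w)

  -- The stack time is at most E · (y + 1) for the clock value y; `K₀` is a coefficient of (y + 1)²
  -- that suffices after compilation.
  E K₀ : ℕ
  E  = 96 + length W
  K₀ = 4 + E * (5 + 2 * E)

  time-bound : ∀ n → (let T = (length W + 92 * clock n) + (2 + clock n * 2)) →
    2 + T * (2 * (suc n + T) + 3) ≤ quad K₀ (clock n)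
  time-bound n = begin
    2 + T * (2 * (suc n + T) + 3)                ≤⟨ +-monoʳ-≤ 2 (*-mono-≤ T≤ (+-monoˡ-≤ 3 (*-monoʳ-≤ 2 (+-mono-≤ n≤ T≤)))) ⟩
    2 + E * Y * (2 * (Y + E * Y) + 3)            ≤⟨ m≤m+n _ (2 + 4 * y * (2 + y) + 3 * E * (y * Y)) ⟩
    2 + E * Y * (2 * (Y + E * Y) + 3) + (2 + 4 * y * (2 + y) + 3 * E * (y * Y)) ≡⟨ identity y E ⟩
    K₀ * (Y * Y)                                 ∎
    where
    open ≤-Reasoning
    y Y T : ℕ
    y = clock n
    Y = suc y
    T = (length W + 92 * y) + (2 + y * 2)
    n≤ : suc n ≤ Y
    n≤ = s≤s (≤-trans (m≤n+m n 2) (n≤clock n))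
    T≤ : T ≤ E * Y
    T≤ = ≤-trans (m≤m+n T (94 + 2 * y + length W * y)) (≤-reflexive (T-identity (length W) y))
      where
      T-identity : ∀ l y → (l + 92 * y) + (2 + y * 2) + (94 + 2 * y + l * y) ≡ (96 + l) * suc y
      T-identity = solve-∀
    identity : ∀ y E → 2 + E * suc y * (2 * (suc y + E * suc y) + 3) + (2 + 4 * y * (2 + y) + 3 * E * (y * suc y)) ≡
      (4 + E * (5 + 2 * E)) * (suc y * suc y)
    identity = solve-∀

  4≤K₀ : 4 ≤ K₀
  4≤K₀ = m≤m+n 4 _

  -- The time is `quad K₀` of the clock value, and `iter-quad` moves this overhead into the argument
  -- 2 + n, which becomes `pad K₀ (2 + n)`.
  member : 𝐅 (suc c) β language
  member = (λ n → pad K₀ (2 + n)) , 𝓕<-pad (𝟎<two≤ 2≤β) K₀ 2 , Machine.M , λ w y i →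
    Machine.compile-halts w (proj₂ (verdict w)) (≤-trans (time-bound (length w))
      (≤-trans (iter-quad (F-mono β) (F-infl β) 4≤K₀ (F-quad (two≤⇒NotUnit 2≤β) 4≤K₀) c (s≤s z≤n))
        (≤-reflexive (sym (iter-value i)))))

  -- A machine deciding the language within F_β^c of an iterate of F_δ, δ < β,
  -- is simulated to the end on its own table, if that is padded far enough.
  module _ (1≤c : 1 ≤ c) (M : TM) (δ : Ord) (δ≢𝟎 : δ ≢ 𝟎) (m : ℕ) (p : ℕ → ℕ)
    (p≤ : ∀ n → p n ≤ iter (F δ) m n) where

    S K₁ : ℕ
    S  = stepCost M
    K₁ = 7 + S

    time : ℕ → ℕ
    time n = iter (F β) c (p n)

    -- Two applications double twice, and each of the other 2 + K₁ adds at least 1.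
    pad-iter : ∀ z → pad K₁ z ≤ iter (F δ) (2 + (2 + K₁)) z
    pad-iter z = ≤-trans (≤-reflexive (+-comm ((z + z) + (z + z)) (2 + K₁)))
      (≤-trans (+-monoʳ-≤ (2 + K₁) (≤-trans (+-mono-≤ (2z≤ z) (2z≤ z)) (2z≤ (F δ z))))
        (iter-adds (F-infl δ) (2 + K₁) (F δ (F δ z))))
      where
      2z≤ : ∀ z → z + z ≤ F δ z
      2z≤ z = <⇒≤ (F-double δ≢𝟎 z)

    -- The clock has one more application of F_β than the time bound. Innermost, it dominates the
    -- iterate of F_δ that covers both p and `pad`; the overhead of the simulation is absorbed by
    -- the other c applications, of which there is at least one.
    fuel-suffices : ∀ {n} → 1 ≤ n → iter (F δ) (m + (2 + (2 + K₁))) n ≤ F β n →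
      6 + suc (time n) * S < clock n
    fuel-suffices {n} 1≤n dominated = loop c 1≤c refl
      where
      open ≤-Reasoning
      z : ℕ
      z = iter (F δ) m n
      linear : ∀ t → 6 + suc t * S < quad K₁ t
      linear t = ≤-trans (m≤m+n _ (7 * (t * t) + 14 * t + S * (t * suc t))) (≤-reflexive (identity t S))
        where
        identity : ∀ t S → 7 + suc t * S + (7 * (t * t) + 14 * t + S * (t * suc t)) ≡ (7 + S) * (suc t * suc t)
        identity = solve-∀
      loop : ∀ c′ → 1 ≤ c′ → c ≡ c′ → 6 + suc (time n) * S < clock n
      loop (suc c′) _ refl = begin-strict
        6 + suc (time n) * S                     <⟨ linear (time n) ⟩
        quad K₁ (iter (F β) (suc c′) (p n))      ≤⟨ *-monoʳ-≤ K₁ (*-mono-≤ (s≤s mono) (s≤s mono)) ⟩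
        quad K₁ (iter (F β) (suc c′) z)          ≤⟨ iter-quad (F-mono β) (F-infl β) 4≤K₁ (F-quad (two≤⇒NotUnit 2≤β) 4≤K₁) c′
                                                      (≤-trans 1≤n (iter-infl (F-infl δ) m n)) ⟩
        iter (F β) (suc c′) (pad K₁ z)           ≤⟨ iter-mono (F-mono β) (suc c′) (≤-trans (pad-iter z)
                                                      (≤-trans (≤-reflexive (sym (iter-+ (F δ) m _ n))) dominated)) ⟩
        iter (F β) (suc c′) (F β n)              ≤⟨ iter-mono (F-mono β) (suc (suc c′)) (m≤n+m n 2) ⟩
        clock n                                  ∎
        where
        4≤K₁ : 4 ≤ K₁
        4≤K₁ = m≤m+n 4 (3 + S)
        mono : iter (F β) (suc c′) (p n) ≤ iter (F β) (suc c′) z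
        mono = iter-mono (F-mono β) (suc c′) (p≤ n)

    -- If `M` answered correctly on `w`, the simulation would finish within the fuel, and the
    -- deterministic diagonal machine would halt with its verdict and with the negation of it.
    refutes : ∀ w rest → map bit w ≡ tableCode (table M) rest → 6 + suc (time (length w)) * S < clock (length w) →
      runAct M (time (length w)) (initC w) ≢ just (language w)
    refutes w rest code≡ enough r = not-¬ refl (halts-unique diagonal (proj₂ (verdict w)) simulated)
      where
      n : ℕ
      n = length w
      universal-halts : Halts universal (6 + suc (time n) * S) (loadR , mem [] [] [] [] (map bit w) (tapeOf w)) (not (language w))
      universal-halts = subst₂ (λ z e → Halts universal (6 + suc (time n) * S) (loadR , mem [] [] [] [] z e) (not (language w)))
        (sym code≡) (sym (tapeOf-tape M w)) (sim-init M [] rest (time n) w (language w) r)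
      simulated : Halts diagonal ((length W + 92 * clock n) + (2 + (6 + suc (time n) * S) * 2)) (charge₁ , Machine.σ₀ w) (not (language w))
      simulated = _⟫ₕ_ diagonal (prepare w)
        (fuel-sim (λ _ → refl) (λ u → fuelled-lift (universal u)) refl universal-halts (ticks (clock n))
          (≤-trans enough (≤-reflexive (sym (length-ticks (clock n))))))

  nonmember : 1 ≤ c → ¬ 𝐅 c β language
  nonmember 1≤c (p , 𝓹 , M , d) with 𝓕<-bound {p = p} 2≤β 𝓹
  ... | δ , cδ , δ<β , δ≢𝟎 , m , p≤ with F-dominates δ<β cδ (m + (2 + (2 + K₁ 1≤c M δ δ≢𝟎 m p p≤)))
  ...   | start , dominated = refutes 1≤c M δ δ≢𝟎 m p p≤ w (map bit padding) (tableCode-word (table M) padding)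
      (fuel-suffices 1≤c M δ δ≢𝟎 m p p≤ (≤-trans (s≤s z≤n) long) (dominated (≤-trans (n≤1+n start) long)))
      (d w _ (iter-Iter (F-graph β) c (p (length w))))
    where
    -- The padding follows the table, where the index never points. It makes the word longer than
    -- the threshold for domination, and nonempty as `fuel-suffices` requires.
    padding w : List Bool
    padding = replicate (suc start) false
    w = tableWord (table M) padding
    long : suc start ≤ length w
    long = ≤-trans (≤-reflexive (sym (List.length-replicate (suc start)))) (tableWord-length (table M) padding)

theorem5p3 : (c : ℕ) → c ≥ 1 → (β α : Ord) → IsCNF β → IsCNF α →
    two ≤ₒ β → β <ₒ α →
    (𝐅 c β ⊊C 𝐅 (suc c) β) × (𝐅 (suc c) β ⊊C 𝐅 1 α)
theorem5p3 c 1≤c β α cβ cα 2≤β β<α =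
  (𝐅-step c β , language 2≤β c , member 2≤β c , nonmember 2≤β c 1≤c) ,
  (𝐅-up (suc c) cβ 2≤β β<α , language 2≤β (suc c) ,
    𝐅-up (suc (suc c)) cβ 2≤β β<α _ (member 2≤β (suc c)) , nonmember 2≤β (suc c) (s≤s z≤n))
  where open Witness β
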